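{- Let $w={\bf c}^{n_0}{\bf d}{\bf c}^{n_1}{\bf d}\cdots{\bf d}{\bf c}^{n_k}$ with $k\ge0$ and $n_0,\dots,n_k\ge0$. Then $$\Xi_w=(-1)^{k+\frac{|w|-n_0}{2}}\left(q^{ -\frac{n_0+1}{2}}B_{n_0}(-q)-q^{\frac{n_0+1}{2}}B_{n_0}\!\left(\tfrac{ -1}{q}\right)\right)\prod_{j=1}^kC_{\frac{n_j}{2}}.$$ In particular, $\Xi_w=0$ unless $n_1\equiv n_2\equiv\cdots\equiv n_k\equiv0\pmod 2$.
   Context: ${\bf c},{\bf d}$ are noncommuting variables of degrees $1$ and $2$; $|w|$ is the degree of a ${\bf cd}$-word $w$. $C_i=\frac{1}{2i+1}\binom{2i+1}{i}$ is the $i$-th Catalan number for $i\in\mathbb N$, and $C_i=0$ if $i\notin\mathbb N$ (so the product above is $0$ when some $n_j$, $j\ge1$, is odd). The ballot polynomial is $B_k(q)=\sum_{i=0}^{\lfloor k/2\rfloor}\frac{k+1-2i}{k+1}\binom{k+1}{i}q^i$. Quasisymmetric functions: $M_\alpha=\sum_{i_1<\cdots<i_k}x_{i_1}^{\alpha_1}\cdots x_{i_k}^{\alpha_k}$ for a composition $\alpha=\alpha_1\cdots\alpha_k$, $L_\beta=\sum_{\alpha\text{ refines }\beta}M_\alpha$, and $L^{(n)}_T=L_\beta$ for the composition $\beta$ of $n$ corresponding to $T\subseteq[n-1]$ via $\beta_1\cdots\beta_r\mapsto\{\beta_1,\beta_1+\beta_2,\dots,\beta_1+\cdots+\beta_{r-1}\}$.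 For a ${\bf cd}$-word written $w={\bf c}^{p_1}{\bf d}{\bf c}^{p_2}{\bf d}\cdots{\bf c}^{p_r}{\bf d}{\bf c}^{p_0}$ of degree $n$, let $m_j=\deg({\bf c}^{p_1}{\bf d}\cdots{\bf c}^{p_j}{\bf d})$ and $\Theta_w=\sum L^{(n+1)}_T$ over $T\subseteq[n]$ such that both $T$ and $[n]\setminus T$ meet every $\{m_j-1,m_j\}$, $j=1,\dots,r$. For $j\in\mathbb Q$, $D_j(\sum_ia_iq^i)=\sum_{i=0}^{\lfloor j\rfloor}a_iq^i$. For a nonempty composition $\alpha=\alpha_1\cdots\alpha_k$ with $|\alpha|=\sum\alpha_i$: $\Psi_\alpha=(q-1)^{|\alpha|}$ if $k=1$, and $\Psi_\alpha=(q-1)^{\alpha_1}D_{(|\alpha^-|-1)/2}(\Psi_{\alpha^- })$ with $\alpha^-=\alpha_2\cdots\alpha_k$ if $k\ge2$. $\mathcal K$ is the linear map into $\mathbb Z[q^{1/2},q^{ -1/2}]$ with $\mathcal K(M_\alpha)=(-1)^{k}q^{ -|\alpha|/2}\Psi_\alpha$, and $\Xi_w=\mathcal K(\Theta_w)$. -}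

module Defs where

open import Data.Bool using (Bool; true; false; if_then_else_; _∧_; _∨_; not; _xor_)
open import Data.Nat as ℕ using (ℕ; zero; suc; _∸_)
open import Data.Nat.Combinatorics using (_C_)
open import Data.Nat.DivMod using (_/_; _%_)
open import Data.Integer as ℤ using (ℤ; +_; -_)
open import Data.Rational as ℚ using (ℚ; 0ℚ; 1ℚ)
open import Data.List using (List; []; _∷_; _++_; concatMap; map; length; upTo; foldr)
open import Data.Nat.ListAction using (sum)
open import Data.Product using (_×_; _,_; proj₁; proj₂)
open import Relation.Nullary.Decidable using (does)

-- Laurent polynomials in q^{1/2} with rational coefficients
-- (ℤ[q^{1/2},q^{-1/2}] embeds into this).  A polynomial is a formal
-- finite sum of terms (e , a) meaning  a · q^{e/2}; two polynomials are
-- equal when all their coefficients agree (see _≈P_).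

Poly : Set
Poly = List (ℤ × ℚ)

coeff : Poly → ℤ → ℚ
coeff []             e = 0ℚ
coeff ((f , a) ∷ ps) e = if does (f ℤ.≟ e) then a ℚ.+ coeff ps e else coeff ps e

_≈P_ : Poly → Poly → Set
p ≈P r = ∀ e → coeff p e ≡ coeff r e
  where open import Relation.Binary.PropositionalEquality using (_≡_)

_⊕_ : Poly → Poly → Poly
_⊕_ = _++_

_⊗_ : Poly → Poly → Poly
p ⊗ r = concatMap (λ { (e , a) → map (λ { (f , b) → (e ℤ.+ f , a ℚ.* b) }) r }) p

scaleP : ℚ → Poly → Poly
scaleP c = map (λ { (e , a) → (e , c ℚ.* a) })

negP : Poly → Poly
negP = scaleP (ℚ.- 1ℚ)

onePoly : Poly
onePoly = (+ 0 , 1ℚ) ∷ []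

qHalf : ℤ → Poly
qHalf e = (e , 1ℚ) ∷ []

_^P_ : Poly → ℕ → Poly
p ^P zero  = onePoly
p ^P suc n = p ⊗ (p ^P n)

signℚ : ℕ → ℚ
signℚ zero    = 1ℚ
signℚ (suc n) = ℚ.- signℚ n

qMinus1 : Poly
qMinus1 = (+ 2 , 1ℚ) ∷ (+ 0 , ℚ.- 1ℚ) ∷ []

-- D_j for j with ⌊j⌋ = J : keep the terms q^i with i ≤ J (i.e. half-exponent ≤ 2J)
truncD : ℕ → Poly → Poly
truncD J []             = []
truncD J ((e , a) ∷ ps) =
  if e ℤ.≤ᵇ + (2 ℕ.* J) then (e , a) ∷ truncD J ps else truncD J ps

-- subset T ⊆ [n] given by bits b_1 … b_n (b_i = true iff i ∈ T) ↦
-- the composition of n+1 whose set of partial sums is T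
compGo : ℕ → List Bool → List ℕ
compGo c []            = c ∷ []
compGo c (true  ∷ bs)  = c ∷ compGo 1 bs
compGo c (false ∷ bs)  = compGo (suc c) bs

bitsToComp : List Bool → List ℕ
bitsToComp = compGo 1

allBits : ℕ → List (List Bool)
allBits zero    = [] ∷ []
allBits (suc n) = concatMap (λ bs → (false ∷ bs) ∷ (true ∷ bs) ∷ []) (allBits n)

compositions : ℕ → List (List ℕ)
compositions zero    = [] ∷ []
compositions (suc m) = map bitsToComp (allBits m)

refinements : List ℕ → List (List ℕ)
refinements []      = [] ∷ []
refinements (b ∷ β) = concatMap (λ α → map (α ++_) (refinements β)) (compositions b)

Ψ : List ℕ → Poly
Ψ []                  = onePoly   -- not used: compositions below are nonempty
Ψ (a ∷ [])            = qMinus1 ^P a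
Ψ (a ∷ α@(_ ∷ _))     = (qMinus1 ^P a) ⊗ truncD ((sum α ∸ 1) / 2) (Ψ α)

𝒦M : List ℕ → Poly
𝒦M α = scaleP (signℚ (length α)) (qHalf (- (+ sum α)) ⊗ Ψ α)

𝒦L : List ℕ → Poly
𝒦L β = concatMap 𝒦M (refinements β)

data Letter : Set where
  𝐜 𝐝 : Letter

deg : List Letter → ℕ
deg []      = 0
deg (𝐜 ∷ w) = suc (deg w)
deg (𝐝 ∷ w) = suc (suc (deg w))

dMarksGo : ℕ → List Letter → List ℕ
dMarksGo acc []      = []
dMarksGo acc (𝐜 ∷ w) = dMarksGo (suc acc) w
dMarksGo acc (𝐝 ∷ w) = (acc ℕ.+ 2) ∷ dMarksGo (acc ℕ.+ 2) w

dMarks : List Letter → List ℕ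
dMarks = dMarksGo 0

-- membership i ∈ T for T given by bits b_1 … b_n (i ≥ 1)
memb : ℕ → List Bool → Bool
memb i       []       = false
memb zero    (b ∷ bs) = false
memb (suc zero) (b ∷ bs) = b
memb (suc (suc i)) (b ∷ bs) = memb (suc i) bs

meetsBoth : List Bool → ℕ → Bool
meetsBoth T m = (memb (m ∸ 1) T ∨ memb m T) ∧ (not (memb (m ∸ 1) T) ∨ not (memb m T))

admissible : List ℕ → List Bool → Bool
admissible ms T = foldr (λ m b → meetsBoth T m ∧ b) true ms

filterB : {A : Set} → (A → Bool) → List A → List A
filterB p []       = []
filterB p (x ∷ xs) = if p x then x ∷ filterB p xs else filterB p xs

-- Θ_w = Σ_{T admissible} L^{(n+1)}_T, and Ξ_w = 𝒦(Θ_w)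
Ξ : List Letter → Poly
Ξ w = concatMap (λ T → 𝒦L (bitsToComp T)) (filterB (admissible (dMarks w)) (allBits (deg w)))

cPow : ℕ → List Letter
cPow zero    = []
cPow (suc n) = 𝐜 ∷ cPow n

cdWord : ℕ → List ℕ → List Letter
cdWord n0 []       = cPow n0
cdWord n0 (n ∷ ns) = cPow n0 ++ (𝐝 ∷ cdWord n ns)

ballotCoeff : ℕ → ℕ → ℚ
ballotCoeff k i = (+ (((k ℕ.+ 1) ∸ 2 ℕ.* i) ℕ.* ((k ℕ.+ 1) C i))) ℚ./ (suc k)

-- q^{-(n0+1)/2} B_{n0}(-q) - q^{(n0+1)/2} B_{n0}(-1/q)
ballotPart : ℕ → Poly
ballotPart n0 =
  concatMap (λ i → (ℤ.+ (2 ℕ.* i) ℤ.- + (n0 ℕ.+ 1) , signℚ i ℚ.* ballotCoeff n0 i)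
                 ∷ (+ (n0 ℕ.+ 1) ℤ.- + (2 ℕ.* i) , ℚ.- (signℚ i ℚ.* ballotCoeff n0 i))
                 ∷ [])
            (upTo (suc (n0 / 2)))

catalan : ℕ → ℚ
catalan i = (+ ((2 ℕ.* i ℕ.+ 1) C i)) ℚ./ (suc (2 ℕ.* i))

catalanHalf : ℕ → ℚ
catalanHalf n = if does (n % 2 ℕ.≟ 0) then catalan (n / 2) else 0ℚ

RHS : ℕ → List ℕ → Poly
RHS n0 ns =
  scaleP (signℚ (length ns ℕ.+ (deg (cdWord n0 ns) ∸ n0) / 2)
          ℚ.* foldr (λ n c → catalanHalf n ℚ.* c) 1ℚ ns)
         (ballotPart n0)

{-# OPTIONS --safe #-}
-- Put z = q^{1/2} and X = z − z⁻¹, and let P and Q = 1 − P project a Laurent polynomial in z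
-- onto its negative and nonnegative powers.  The normalisation q^{-|α|/2} turns every truncation
-- in Ψ into P, so that, reading T ⊆ [n] from left to right, 𝒦(L_T) is obtained from −X by
-- applying −XP for each i ∈ T and XQ for each i ∉ T.  Summing over the admissible T, a letter 𝐜
-- of w acts as XQ − XP and a letter 𝐝 as −(XP·XQ + XQ·XP), the first letter of w being
-- outermost.  On polynomials with no constant term the operator of 𝐝 is g ↦ [z⁻¹]g · (−X),
-- and with E_m = z^{-m} − z^m that of 𝐜 sends E_m to E_{m+1} − E_{m−1} for m ≥ 1.  Hence
-- U_n = 𝐜ⁿ(−X) = 𝐜ⁿ(E₁) = Σ_i (−1)^i b(n,i) E_{n+1−2i} with b(n,i) the ballot numbers, and
-- Ξ_w is U_{n₀} times the product of the coefficients [z⁻¹] U_{n_j}, which are signed Catalan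
-- numbers.  Polynomials are handled through their coefficient functions, indexed by powers of z.

module Submission where

open import Defs
open import Data.Bool using (Bool; T; true; false; if_then_else_; _∧_)
open import Data.Empty using (⊥-elim)
open import Data.Integer as ℤ using (ℤ; +_; -[1+_]; 1ℤ; 0ℤ)
import Data.Integer.Properties as ℤₚ
import Data.Integer.Tactic.RingSolver as ℤ-Solver
open import Data.List using (List; []; _∷_; _++_; concatMap; map; length; upTo; applyUpTo; foldr)
open import Data.List.Properties using (++-identityʳ)
open import Data.Nat as ℕ using (ℕ; zero; suc; _∸_)
open import Data.Nat.Combinatorics using (_C_; k>n⇒nCk≡0; nCk+nC[k+1]≡[n+1]C[k+1])
open import Data.Nat.Divisibility using (∣-refl; m%n≡0⇒n∣m)
open import Data.Nat.DivMod using (_/_; _%_; m≡m%n+[m/n]*n; m%n<n; m/n*n≤m; m/n≤m; +-distrib-/-∣ˡ)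
open import Data.Nat.ListAction using (sum)
import Data.Nat.Properties as ℕₚ
import Data.Nat.Tactic.RingSolver as ℕ-Solver
open import Data.Product using (_,_; ∃; proj₂)
open import Data.Rational as ℚ using (ℚ; 0ℚ; 1ℚ; _+_; _*_; _-_; -_)
import Data.Rational.Properties as ℚₚ
open import Data.Rational.Unnormalised using (mkℚᵘ; *≡*)
import Data.Rational.Unnormalised.Properties as ℚᵘₚ
open import Function using (_∘_; _$_; id)
open import Level using (0ℓ)
open import Relation.Binary.Definitions using (Tri; tri<; tri≈; tri>)
open import Relation.Binary.PropositionalEquality
open import Relation.Nullary using (Dec; yes; no; does; contradiction)
open import Relation.Nullary.Decidable using (dec⇒maybe; dec-true; dec-false)
open import Tactic.RingSolver using () renaming (solve-∀ to ring-∀)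
open import Tactic.RingSolver.Core.AlmostCommutativeRing using (AlmostCommutativeRing; fromCommutativeRing)

open ≡-Reasoning

-- Finite sums of rational numbers.

ℚ-ring : AlmostCommutativeRing 0ℓ 0ℓ
ℚ-ring = fromCommutativeRing ℚₚ.+-*-commutativeRing (λ p → dec⇒maybe (0ℚ ℚₚ.≟ p))

+-congˡ : ∀ x {y z} → y ≡ z → x + y ≡ x + z
+-congˡ x = cong (x ℚ.+_)

+-interchange : ∀ a b c d → (a + b) + (c + d) ≡ (a + c) + (b + d)
+-interchange = ring-∀ ℚ-ring

∑ : {A : Set} → (A → ℚ) → List A → ℚ
∑ f []       = 0ℚ
∑ f (x ∷ xs) = f x + ∑ f xs

module _ {A : Set} where

  ∑-cong : {f g : A → ℚ} → (∀ x → f x ≡ g x) → ∀ xs → ∑ f xs ≡ ∑ g xs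
  ∑-cong eq []       = refl
  ∑-cong eq (x ∷ xs) = cong₂ _+_ (eq x) (∑-cong eq xs)

  ∑-++ : (f : A → ℚ) → ∀ xs ys → ∑ f (xs ++ ys) ≡ ∑ f xs + ∑ f ys
  ∑-++ f []       ys = sym (ℚₚ.+-identityˡ _)
  ∑-++ f (x ∷ xs) ys = trans (+-congˡ (f x) (∑-++ f xs ys)) (sym (ℚₚ.+-assoc (f x) (∑ f xs) (∑ f ys)))

  ∑-+ : (f g : A → ℚ) → ∀ xs → ∑ (λ x → f x + g x) xs ≡ ∑ f xs + ∑ g xs
  ∑-+ f g []       = refl
  ∑-+ f g (x ∷ xs) = trans (+-congˡ (f x + g x) (∑-+ f g xs)) (+-interchange (f x) (g x) (∑ f xs) (∑ g xs))
  ∑-map : {B : Set} (f : A → ℚ) (h : B → A) → ∀ xs → ∑ f (map h xs) ≡ ∑ (f ∘ h) xs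
  ∑-map f h []       = refl
  ∑-map f h (x ∷ xs) = +-congˡ (f (h x)) (∑-map f h xs)

  ∑-concatMap : {B : Set} (f : A → ℚ) (h : B → List A) →
                ∀ xs → ∑ f (concatMap h xs) ≡ ∑ (∑ f ∘ h) xs
  ∑-concatMap f h []       = refl
  ∑-concatMap f h (x ∷ xs) =
    trans (∑-++ f (h x) (concatMap h xs)) (+-congˡ (∑ f (h x)) (∑-concatMap f h xs))

  ∑-filterB : (p : A → Bool) (f : A → ℚ) →
              ∀ xs → ∑ f (filterB p xs) ≡ ∑ (λ x → if p x then f x else 0ℚ) xs
  ∑-filterB p f []       = refl
  ∑-filterB p f (x ∷ xs) with p x
  ... | true  = +-congˡ (f x) (∑-filterB p f xs)
  ... | false = trans (∑-filterB p f xs) (sym (ℚₚ.+-identityˡ _))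

-- Coefficients of Laurent polynomials

coeff-++ : ∀ p r e → coeff (p ++ r) e ≡ coeff p e + coeff r e
coeff-++ []            r e = sym (ℚₚ.+-identityˡ _)
coeff-++ ((f , a) ∷ p) r e with does (f ℤ.≟ e)
... | true  = trans (+-congˡ a (coeff-++ p r e)) (sym (ℚₚ.+-assoc a (coeff p e) (coeff r e)))
... | false = coeff-++ p r e

coeff-concatMap : {A : Set} (h : A → Poly) →
                  ∀ xs e → coeff (concatMap h xs) e ≡ ∑ (λ x → coeff (h x) e) xs
coeff-concatMap h []       e = refl
coeff-concatMap h (x ∷ xs) e =
  trans (coeff-++ (h x) (concatMap h xs) e) (+-congˡ (coeff (h x) e) (coeff-concatMap h xs e))

coeff-scaleP : ∀ c p e → coeff (scaleP c p) e ≡ c * coeff p e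
coeff-scaleP c []            e = sym (ℚₚ.*-zeroʳ c)
coeff-scaleP c ((f , a) ∷ p) e with does (f ℤ.≟ e)
... | true  = trans (+-congˡ (c * a) (coeff-scaleP c p e)) (sym (ℚₚ.*-distribˡ-+ c a (coeff p e)))
... | false = coeff-scaleP c p e

Coeffs : Set
Coeffs = ℤ → ℚ

δ : Coeffs
δ (+ 0)     = 1ℚ
δ (+ suc _) = 0ℚ
δ -[1+ _ ]  = 0ℚ

δ-≢0 : ∀ {x} → x ≢ 0ℤ → δ x ≡ 0ℚ
δ-≢0 {+ zero}   x≢0 = ⊥-elim (x≢0 refl)
δ-≢0 {+ suc _}  _   = refl
δ-≢0 { -[1+ _ ]} _   = refl

infix 8 _⊛_

-- p ⊛ g is the product of p with the (arbitrary) series whose coefficient function is g.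
_⊛_ : Poly → Coeffs → Coeffs
([]            ⊛ g) e = 0ℚ
(((f , a) ∷ p) ⊛ g) e = a * g (e ℤ.- f) + (p ⊛ g) e

-- Moves the test `f ≟ e` into a value of `δ`, so that exponents can afterwards be rearranged by
-- ring identities in ℤ.
coeff-∷ : ∀ f a p e → coeff ((f , a) ∷ p) e ≡ a * δ (e ℤ.- f) + coeff p e
coeff-∷ f a p e with f ℤ.≟ e
... | yes refl = cong (_+ coeff p e) $ begin
  a              ≡⟨ ℚₚ.*-identityʳ a ⟨
  a * 1ℚ         ≡⟨ cong (λ x → a * δ x) (ℤₚ.+-inverseʳ f) ⟨
  a * δ (f ℤ.- f) ∎
... | no f≢e = begin
  coeff p e                        ≡⟨ ℚₚ.+-identityˡ _ ⟨
  0ℚ + coeff p e                   ≡⟨ cong (_+ coeff p e) (ℚₚ.*-zeroʳ a) ⟨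
  a * 0ℚ + coeff p e               ≡⟨ cong (λ x → a * x + coeff p e) (δ-≢0 (f≢e ∘ sym ∘ ℤₚ.i-j≡0⇒i≡j e f)) ⟨
  a * δ (e ℤ.- f) + coeff p e      ∎

coeff≗⊛δ : ∀ p → coeff p ≗ p ⊛ δ
coeff≗⊛δ []            e = refl
coeff≗⊛δ ((f , a) ∷ p) e =
  trans (coeff-∷ f a p e) (+-congˡ (a * δ (e ℤ.- f)) (coeff≗⊛δ p e))

⊛-cong : ∀ p {g h} → g ≗ h → p ⊛ g ≗ p ⊛ h
⊛-cong []            g≗h e = refl
⊛-cong ((f , a) ∷ p) g≗h e = cong₂ (λ x y → a * x + y) (g≗h _) (⊛-cong p g≗h e)

++-⊛ : ∀ p r g e → ((p ++ r) ⊛ g) e ≡ (p ⊛ g) e + (r ⊛ g) e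
++-⊛ []            r g e = sym (ℚₚ.+-identityˡ _)
++-⊛ ((f , a) ∷ p) r g e =
  trans (+-congˡ (a * g (e ℤ.- f)) (++-⊛ p r g e)) (sym (ℚₚ.+-assoc (a * g (e ℤ.- f)) ((p ⊛ g) e) ((r ⊛ g) e)))

-- Makes `⊛` an action of `Poly` on arbitrary series; applied to `δ`, the coefficient function of 1,
-- it yields the coefficients of a product.
⊗-⊛ : ∀ p r g → (p ⊗ r) ⊛ g ≗ p ⊛ (r ⊛ g)
⊗-⊛ []            r g e = refl
⊗-⊛ ((f , a) ∷ p) r g e =
  trans (++-⊛ (map _ r) (p ⊗ r) g e) (cong₂ _+_ (monomial r) (⊗-⊛ p r g e))
  where
  minus-distrib : ∀ e f h → e ℤ.- (f ℤ.+ h) ≡ e ℤ.- f ℤ.- h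
  minus-distrib = ℤ-Solver.solve-∀
  factor : ∀ a b x y → a * b * x + a * y ≡ a * (b * x + y)
  factor = ring-∀ ℚ-ring
  monomial : ∀ r → (map (λ { (h , b) → (f ℤ.+ h , a * b) }) r ⊛ g) e ≡ a * (r ⊛ g) (e ℤ.- f)
  monomial []            = sym (ℚₚ.*-zeroʳ a)
  monomial ((h , b) ∷ r) = trans
    (cong₂ (λ x y → a * b * g x + y) (minus-distrib e f h) (monomial r))
    (factor a b (g (e ℤ.- f ℤ.- h)) ((r ⊛ g) (e ℤ.- f)))

coeff-⊗ : ∀ p r → coeff (p ⊗ r) ≗ p ⊛ coeff r
coeff-⊗ p r e = begin
  coeff (p ⊗ r) e      ≡⟨ coeff≗⊛δ (p ⊗ r) e ⟩
  ((p ⊗ r) ⊛ δ) e      ≡⟨ ⊗-⊛ p r δ e ⟩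
  (p ⊛ (r ⊛ δ)) e      ≡⟨ ⊛-cong p (coeff≗⊛δ r) e ⟨
  (p ⊛ coeff r) e      ∎

qMinus1^-⊛ : ∀ a g e → ((qMinus1 ^P suc a) ⊛ g) e ≡
             ((qMinus1 ^P a) ⊛ g) (e ℤ.- + 2) - ((qMinus1 ^P a) ⊛ g) e
qMinus1^-⊛ a g e = trans (⊗-⊛ qMinus1 (qMinus1 ^P a) g e) $
  trans (cong (λ x → 1ℚ * h (e ℤ.- + 2) + (- 1ℚ * h x + 0ℚ)) (ℤₚ.+-identityʳ e)) (tidy (h (e ℤ.- + 2)) (h e))
  where
  h = (qMinus1 ^P a) ⊛ g
  tidy : ∀ x y → 1ℚ * x + (- 1ℚ * y + 0ℚ) ≡ x - y
  tidy = ring-∀ ℚ-ring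

onePoly-⊛ : ∀ g → onePoly ⊛ g ≗ g
onePoly-⊛ g e = trans (cong (λ x → 1ℚ * g x + 0ℚ) (ℤₚ.+-identityʳ e)) (tidy (g e))
  where
  tidy : ∀ x → 1ℚ * x + 0ℚ ≡ x
  tidy = ring-∀ ℚ-ring

-- mulX, neg, nonneg are X·, P, Q; join = XQ and cut = −XP act for i ∉ T and i ∈ T.
mulX nonneg neg join cut : Coeffs → Coeffs
mulX g e = g (e ℤ.- 1ℤ) - g (e ℤ.+ 1ℤ)

nonneg g (+ n)    = g (+ n)
nonneg g -[1+ n ] = 0ℚ

neg g (+ n)    = 0ℚ
neg g -[1+ n ] = g -[1+ n ]

join g = mulX (nonneg g)
cut  g = mulX (λ e → - neg g e)

-- Parity of exponents and the truncations in Ψ.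

OddFree : Coeffs → Set
OddFree g = ∀ k → g (k ℤ.+ k ℤ.+ 1ℤ) ≡ 0ℚ

qMinus1^-OddFree : ∀ a {g} → OddFree g → OddFree ((qMinus1 ^P a) ⊛ g)
qMinus1^-OddFree zero    {g} o k = trans (onePoly-⊛ g _) (o k)
qMinus1^-OddFree (suc a) {g} o k =
  trans (qMinus1^-⊛ a g _) $
  cong₂ _-_ (trans (cong ((qMinus1 ^P a) ⊛ g) (shift k)) (qMinus1^-OddFree a o (k ℤ.- 1ℤ)))
            (qMinus1^-OddFree a o k)
  where
  shift : ∀ k → k ℤ.+ k ℤ.+ 1ℤ ℤ.- + 2 ≡ (k ℤ.- 1ℤ) ℤ.+ (k ℤ.- 1ℤ) ℤ.+ 1ℤ
  shift = ℤ-Solver.solve-∀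

coeff-truncD : ∀ J p e → coeff (truncD J p) e ≡ (if e ℤ.≤ᵇ + (2 ℕ.* J) then coeff p e else 0ℚ)
coeff-truncD J []            e with e ℤ.≤ᵇ + (2 ℕ.* J)
... | true  = refl
... | false = refl
coeff-truncD J ((f , a) ∷ p) e with f ℤ.≟ e
coeff-truncD J ((f , a) ∷ p) .f | yes refl with f ℤ.≤ᵇ + (2 ℕ.* J) in le
-- The comparison inside `coeff` reappears once the truncated list is known to keep its head, so it
-- is decided a second time.
... | true with f ℤ.≟ f
...   | yes _ = +-congˡ a (trans (coeff-truncD J p f) (cong (if_then coeff p f else 0ℚ) le))
...   | no f≢f = ⊥-elim (f≢f refl)
coeff-truncD J ((f , a) ∷ p) .f | yes refl | false =
  trans (coeff-truncD J p f) (cong (if_then coeff p f else 0ℚ) le)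
coeff-truncD J ((f , a) ∷ p) e | no f≢e with f ℤ.≤ᵇ + (2 ℕ.* J)
... | false = coeff-truncD J p e
... | true with f ℤ.≟ e
...   | yes f≡e = ⊥-elim (f≢e f≡e)
...   | no _ = coeff-truncD J p e
≤ᵇ-true : ∀ {i j} → i ℤ.≤ j → (i ℤ.≤ᵇ j) ≡ true
≤ᵇ-true {i} {j} i≤j with i ℤ.≤ᵇ j | ℤₚ.≤⇒≤ᵇ i≤j
... | true | _ = refl

≤ᵇ-false : ∀ {i j} → (i ℤ.≤ᵇ j) ≡ false → i ℤ.≰ j
≤ᵇ-false eq i≤j with () ← trans (sym (≤ᵇ-true i≤j)) eq

-- Only even powers of q^{1/2} occur in Ψ, so keeping the exponents ≤ ⌊(N-1)/2⌋ of q
-- amounts to keeping the exponents < N of q^{1/2}.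
coeff-truncD-OddFree : ∀ M p → OddFree (coeff p) →
  (λ e → coeff (truncD (M / 2) p) (e ℤ.+ + suc M)) ≗ neg (λ e → coeff p (e ℤ.+ + suc M))
coeff-truncD-OddFree M p o (+ n) = trans (coeff-truncD (M / 2) p (+ n ℤ.+ + suc M)) too-big
  where
  too-big : (if (+ n ℤ.+ + suc M) ℤ.≤ᵇ + (2 ℕ.* (M / 2)) then coeff p (+ n ℤ.+ + suc M) else 0ℚ) ≡ 0ℚ
  too-big with (n ℕ.+ suc M) ℕ.≤ᵇ (2 ℕ.* (M / 2)) in eq
  ... | false = refl
  ... | true  = ⊥-elim $ ℕₚ.<⇒≱ (ℕₚ.m≤n+m (suc M) n) $
    ℕₚ.≤-trans (ℕₚ.≤ᵇ⇒≤ _ _ (subst T (sym eq) _)) $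
    subst (ℕ._≤ M) (ℕₚ.*-comm (M / 2) 2) (m/n*n≤m M 2)
coeff-truncD-OddFree M p o -[1+ n ] = trans (coeff-truncD (M / 2) p (suc M ℤ.⊖ suc n)) in-range
  where
  double+1 : ∀ k → + 1 ℤ.+ + 2 ℤ.* k ≡ k ℤ.+ k ℤ.+ 1ℤ
  double+1 = ℤ-Solver.solve-∀
  M≤1+2J : M ℕ.≤ 1 ℕ.+ 2 ℕ.* (M / 2)
  M≤1+2J = subst (ℕ._≤ 1 ℕ.+ 2 ℕ.* (M / 2)) (sym (m≡m%n+[m/n]*n M 2)) $
    ℕₚ.+-mono-≤ (ℕ.s≤s⁻¹ (m%n<n M 2)) (ℕₚ.≤-reflexive (ℕₚ.*-comm (M / 2) 2))
  -- The truncation stops at exponent 2⌊M/2⌋ of z, so the only exponent up to M that can be lost is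
  -- 2⌊M/2⌋ + 1; it is odd and has coefficient zero.
  top : ∀ {x} → x ℤ.≤ + M → x ℤ.≰ + (2 ℕ.* (M / 2)) → x ≡ + (M / 2) ℤ.+ + (M / 2) ℤ.+ 1ℤ
  top x≤M x≰2J = trans
    (ℤₚ.≤-antisym (ℤₚ.≤-trans x≤M (ℤ.+≤+ M≤1+2J)) (ℤₚ.i<j⇒suc[i]≤j (ℤₚ.≰⇒> x≰2J)))
    (trans (cong ℤ.suc (ℤₚ.pos-* 2 (M / 2))) (double+1 (+ (M / 2))))
  bound : suc M ℤ.⊖ suc n ℤ.≤ + M
  bound = subst (ℤ._≤ + M) (sym (ℤₚ.[1+m]⊖[1+n]≡m⊖n M n)) (ℤₚ.m⊖n≤m M n)
  in-range : (if (suc M ℤ.⊖ suc n) ℤ.≤ᵇ + (2 ℕ.* (M / 2)) then coeff p (suc M ℤ.⊖ suc n) else 0ℚ) ≡ coeff p (suc M ℤ.⊖ suc n)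
  in-range with (suc M ℤ.⊖ suc n) ℤ.≤ᵇ + (2 ℕ.* (M / 2)) in eq
  ... | true  = refl
  ... | false = sym (trans (cong (coeff p) (top bound (≤ᵇ-false eq))) (o (+ (M / 2))))

truncD-OddFree : ∀ J p → OddFree (coeff p) → OddFree (coeff (truncD J p))
truncD-OddFree J p o k = trans (coeff-truncD J p (k ℤ.+ k ℤ.+ 1ℤ)) (both (o k))
  where
  both : ∀ {b x} → x ≡ 0ℚ → (if b then x else 0ℚ) ≡ 0ℚ
  both {true}  eq = eq
  both {false} _  = refl

onePoly-OddFree : OddFree (coeff onePoly)
onePoly-OddFree k with + 0 ℤ.≟ k ℤ.+ k ℤ.+ 1ℤ
... | no _ = refl
onePoly-OddFree (+ n) | yes eq with () ← trans eq (cong +_ (ℕₚ.+-comm (n ℕ.+ n) 1))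

-- The factor that (q-1)^{α₁} multiplies in Ψ_α, with α the tail of the composition.
base : List ℕ → Poly
base []        = onePoly
base α@(_ ∷ _) = truncD ((sum α ∸ 1) / 2) (Ψ α)

-- Since `base []` is 1, compositions with one part and with several obey the same recursion in
-- their first part.
coeff-Ψ : ∀ a α → coeff (Ψ (a ∷ α)) ≗ (qMinus1 ^P a) ⊛ coeff (base α)
coeff-Ψ a (_ ∷ _) e = coeff-⊗ (qMinus1 ^P a) _ e
coeff-Ψ a []      e = trans (coeff≗⊛δ (qMinus1 ^P a) e) (⊛-cong (qMinus1 ^P a) δ≗ e)
  where
  δ≗ : δ ≗ coeff onePoly
  δ≗ e = sym (trans (coeff≗⊛δ onePoly e) (onePoly-⊛ δ e))

Ψ-OddFree : ∀ α → OddFree (coeff (Ψ α))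
base-OddFree : ∀ α → OddFree (coeff (base α))

Ψ-OddFree []      = onePoly-OddFree
Ψ-OddFree (a ∷ α) k =
  trans (coeff-Ψ a α (k ℤ.+ k ℤ.+ 1ℤ)) (qMinus1^-OddFree a (base-OddFree α) k)

base-OddFree []        = onePoly-OddFree
base-OddFree α@(_ ∷ _) = truncD-OddFree ((sum α ∸ 1) / 2) (Ψ α) (Ψ-OddFree α)

-- The values of 𝒦 on the M_α.

coeff-𝒦M : ∀ α e → coeff (𝒦M α) e ≡ signℚ (length α) * coeff (Ψ α) (e ℤ.+ + sum α)
coeff-𝒦M α e = begin
  coeff (𝒦M α) e                                            ≡⟨ coeff-scaleP s (m ⊗ Ψ α) e ⟩
  s * coeff (m ⊗ Ψ α) e                                     ≡⟨ cong (s *_) (coeff-⊗ m (Ψ α) e) ⟩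
  s * (1ℚ * coeff (Ψ α) (e ℤ.- ℤ.- (+ sum α)) + 0ℚ)         ≡⟨ cong (s *_) (tidy _) ⟩
  s * coeff (Ψ α) (e ℤ.- ℤ.- (+ sum α))                     ≡⟨ cong (λ x → s * coeff (Ψ α) (e ℤ.+ x)) (ℤₚ.neg-involutive (+ sum α)) ⟩
  s * coeff (Ψ α) (e ℤ.+ + sum α)                           ∎
  where
  s = signℚ (length α)
  m = qHalf (ℤ.- (+ sum α))
  tidy : ∀ x → 1ℚ * x + 0ℚ ≡ x
  tidy = ring-∀ ℚ-ring

-- 𝒦(M_{a∷α}) with the leading part a allowed to be 0.
lead : ℕ → List ℕ → Coeffs
lead a α e = signℚ (suc (length α)) * ((qMinus1 ^P a) ⊛ coeff (base α)) (e ℤ.+ + (a ℕ.+ sum α))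

coeff-𝒦M-∷ : ∀ a α → coeff (𝒦M (a ∷ α)) ≗ lead a α
coeff-𝒦M-∷ a α e =
  trans (coeff-𝒦M (a ∷ α) e) (cong (signℚ (suc (length α)) *_) (coeff-Ψ a α (e ℤ.+ + (a ℕ.+ sum α))))

-- One more unit in the first part multiplies Ψ by q - 1 and the normalisation by z⁻¹, and z⁻¹(q -
-- 1) = X.
lead-suc : ∀ a α → lead (suc a) α ≗ mulX (lead a α)
lead-suc a α e = begin
  s * ((qMinus1 ^P suc a) ⊛ g) (e ℤ.+ + suc N)
    ≡⟨ cong (s *_) (qMinus1^-⊛ a g (e ℤ.+ + suc N)) ⟩
  s * (h (e ℤ.+ + suc N ℤ.- + 2) - h (e ℤ.+ + suc N))
    ≡⟨ cong₂ (λ x y → s * (h x - h y)) (lower e (+ N)) (upper e (+ N)) ⟩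
  s * (h (e ℤ.- 1ℤ ℤ.+ + N) - h (e ℤ.+ 1ℤ ℤ.+ + N))
    ≡⟨ distrib s (h (e ℤ.- 1ℤ ℤ.+ + N)) (h (e ℤ.+ 1ℤ ℤ.+ + N)) ⟩
  mulX (lead a α) e ∎
  where
  s = signℚ (suc (length α))
  N = a ℕ.+ sum α
  g = coeff (base α)
  h = (qMinus1 ^P a) ⊛ g
  lower : ∀ e n → e ℤ.+ (1ℤ ℤ.+ n) ℤ.- + 2 ≡ e ℤ.- 1ℤ ℤ.+ n
  lower = ℤ-Solver.solve-∀
  upper : ∀ e n → e ℤ.+ (1ℤ ℤ.+ n) ≡ e ℤ.+ 1ℤ ℤ.+ n
  upper = ℤ-Solver.solve-∀
  distrib : ∀ s x y → s * (x - y) ≡ s * x - s * y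
  distrib = ring-∀ ℚ-ring

mulX-cong : ∀ {g h} → g ≗ h → mulX g ≗ mulX h
mulX-cong g≗h e = cong₂ _-_ (g≗h (e ℤ.- 1ℤ)) (g≗h (e ℤ.+ 1ℤ))

neg-cong : ∀ {g h} → g ≗ h → neg g ≗ neg h
neg-cong g≗h (+ n)    = refl
neg-cong g≗h -[1+ n ] = g≗h -[1+ n ]

nonneg-cong : ∀ {g h} → g ≗ h → nonneg g ≗ nonneg h
nonneg-cong g≗h (+ n)    = g≗h (+ n)
nonneg-cong g≗h -[1+ n ] = refl

neg-* : ∀ c g → neg (λ e → c * g e) ≗ λ e → c * neg g e
neg-* c g (+ n)    = sym (ℚₚ.*-zeroʳ c)
neg-* c g -[1+ n ] = refl

𝒦M-suc : ∀ a α → coeff (𝒦M (suc a ∷ α)) ≗ mulX (coeff (𝒦M (a ∷ α)))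
𝒦M-suc a α e = begin
  coeff (𝒦M (suc a ∷ α)) e      ≡⟨ coeff-𝒦M-∷ (suc a) α e ⟩
  lead (suc a) α e              ≡⟨ lead-suc a α e ⟩
  mulX (lead a α) e             ≡⟨ mulX-cong (coeff-𝒦M-∷ a α) e ⟨
  mulX (coeff (𝒦M (a ∷ α))) e   ∎

-- The extra part contributes a minus sign and a factor X. The normalisation shifts exponents down
-- by |β|, so the truncation of Ψ_β to exponents of z below |β| becomes the projection P to
-- exponents below 0. The form `suc b` makes |β| positive.
𝒦M-1∷ : ∀ b α → coeff (𝒦M (1 ∷ suc b ∷ α)) ≗ cut (coeff (𝒦M (suc b ∷ α)))
𝒦M-1∷ b α e = begin
  coeff (𝒦M (1 ∷ β)) e  ≡⟨ coeff-𝒦M-∷ 1 β e ⟩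
  lead 1 β e            ≡⟨ lead-suc 0 β e ⟩
  mulX (lead 0 β) e     ≡⟨ mulX-cong lead-0 e ⟩
  cut (coeff (𝒦M β)) e  ∎
  where
  β = suc b ∷ α
  s = signℚ (length β)
  h : Coeffs
  h e = coeff (Ψ β) (e ℤ.+ + sum β)
  neg-distribˡ : ∀ x y → - x * y ≡ - (x * y)
  neg-distribˡ = ring-∀ ℚ-ring
  lead-0 : ∀ e → lead 0 β e ≡ - neg (coeff (𝒦M β)) e
  lead-0 e = begin
    - s * (onePoly ⊛ coeff (base β)) (e ℤ.+ + sum β) ≡⟨ cong (- s *_) (onePoly-⊛ (coeff (base β)) _) ⟩
    - s * coeff (base β) (e ℤ.+ + sum β)             ≡⟨ cong (- s *_) (coeff-truncD-OddFree (b ℕ.+ sum α) (Ψ β) (Ψ-OddFree β) e) ⟩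
    - s * neg h e                                    ≡⟨ neg-distribˡ s (neg h e) ⟩
    - (s * neg h e)                                  ≡⟨ cong -_ (neg-* s h e) ⟨
    - neg (λ x → s * h x) e                          ≡⟨ cong -_ (neg-cong (coeff-𝒦M β) e) ⟨
    - neg (coeff (𝒦M β)) e                           ∎

E : ℤ → Coeffs
E m e = δ (e ℤ.+ m) - δ (e ℤ.- m)

-- The starting value -X = E₁ of the recursion: one sign, one factor X and no truncation.
𝒦M-[1] : coeff (𝒦M (1 ∷ [])) ≗ E 1ℤ
𝒦M-[1] e = begin
  coeff (𝒦M (1 ∷ [])) e                  ≡⟨ coeff-𝒦M-∷ 1 [] e ⟩
  lead 1 [] e                            ≡⟨ lead-suc 0 [] e ⟩
  mulX (lead 0 []) e                     ≡⟨ mulX-cong lead-0 e ⟩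
  mulX (λ x → - δ x) e                   ≡⟨ swap (δ (e ℤ.- 1ℤ)) (δ (e ℤ.+ 1ℤ)) ⟩
  E 1ℤ e                               ∎
  where
  swap : ∀ x y → - x - - y ≡ y - x
  swap = ring-∀ ℚ-ring
  tidy : ∀ x → - 1ℚ * x ≡ - x
  tidy = ring-∀ ℚ-ring
  lead-0 : ∀ e → lead 0 [] e ≡ - δ e
  lead-0 e = begin
    - 1ℚ * (onePoly ⊛ coeff onePoly) (e ℤ.+ + 0) ≡⟨ cong (λ x → - 1ℚ * (onePoly ⊛ coeff onePoly) x) (ℤₚ.+-identityʳ e) ⟩
    - 1ℚ * (onePoly ⊛ coeff onePoly) e  ≡⟨ tidy _ ⟩
    - (onePoly ⊛ coeff onePoly) e  ≡⟨ cong -_ (onePoly-⊛ (coeff onePoly) e) ⟩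
    - coeff onePoly e  ≡⟨ cong -_ (coeff≗⊛δ onePoly e) ⟩
    - (onePoly ⊛ δ) e  ≡⟨ cong -_ (onePoly-⊛ δ e) ⟩
    - δ e ∎
-- Linear operators on coefficient functions

-- Coefficient functions are only known to agree pointwise, so respect for `≗` has to be demanded
-- along with additivity and homogeneity.
record Linear (L : Coeffs → Coeffs) : Set where
  field
    L-cong : ∀ {g h} → g ≗ h → L g ≗ L h
    L-+    : ∀ g h → L (λ e → g e + h e) ≗ λ e → L g e + L h e
    L-*    : ∀ c g → L (λ e → c * g e) ≗ λ e → c * L g e

  L-0 : L (λ _ → 0ℚ) ≗ λ _ → 0ℚ
  L-0 e = trans (L-* 0ℚ (λ _ → 0ℚ) e) (ℚₚ.*-zeroˡ (L (λ _ → 0ℚ) e))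

  L-∑ : {A : Set} (f : A → Coeffs) → ∀ xs →
        L (λ e → ∑ (λ x → f x e) xs) ≗ λ e → ∑ (λ x → L (f x) e) xs
  L-∑ f []       e = L-0 e
  L-∑ f (x ∷ xs) e = trans (L-+ (f x) (λ e → ∑ (λ x → f x e) xs) e) (+-congˡ (L (f x) e) (L-∑ f xs e))

  L-if : ∀ b g → L (λ e → if b then g e else 0ℚ) ≗ λ e → if b then L g e else 0ℚ
  L-if true  g e = refl
  L-if false g e = L-0 e

open Linear

∘-linear : ∀ {L M} → Linear L → Linear M → Linear (L ∘ M)
∘-linear l m .L-cong eq  = l .L-cong (m .L-cong eq)
∘-linear l m .L-+ g h e  = trans (l .L-cong (m .L-+ g h) e) (l .L-+ _ _ e)
∘-linear l m .L-* c g e  = trans (l .L-cong (m .L-* c g) e) (l .L-* c _ e)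

+-linear : ∀ {L M} → Linear L → Linear M → Linear (λ g e → L g e + M g e)
+-linear l m .L-cong eq e = cong₂ _+_ (l .L-cong eq e) (m .L-cong eq e)
+-linear {L} {M} l m .L-+ g h e =
  trans (cong₂ _+_ (l .L-+ g h e) (m .L-+ g h e)) (+-interchange (L g e) (L h e) (M g e) (M h e))
+-linear {L} {M} l m .L-* c g e =
  trans (cong₂ _+_ (l .L-* c g e) (m .L-* c g e)) (sym (ℚₚ.*-distribˡ-+ c (L g e) (M g e)))

mulX-linear : Linear mulX
mulX-linear .L-cong    = mulX-cong
mulX-linear .L-+ g h e = interchange- (g (e ℤ.- 1ℤ)) (h (e ℤ.- 1ℤ)) (g (e ℤ.+ 1ℤ)) (h (e ℤ.+ 1ℤ))
  where
  interchange- : ∀ a b c d → (a + b) - (c + d) ≡ (a - c) + (b - d)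
  interchange- = ring-∀ ℚ-ring
mulX-linear .L-* c g e = distrib c (g (e ℤ.- 1ℤ)) (g (e ℤ.+ 1ℤ))
  where
  distrib : ∀ c x y → c * x - c * y ≡ c * (x - y)
  distrib = ring-∀ ℚ-ring

nonneg-linear : Linear nonneg
nonneg-linear .L-cong            = nonneg-cong
nonneg-linear .L-+ g h (+ n)     = refl
nonneg-linear .L-+ g h -[1+ n ]  = refl
nonneg-linear .L-* c g (+ n)     = refl
nonneg-linear .L-* c g -[1+ n ]  = sym (ℚₚ.*-zeroʳ c)

-neg-linear : Linear (λ g e → - neg g e)
-neg-linear .L-cong eq e      = cong -_ (neg-cong eq e)
-neg-linear .L-+ g h (+ n)    = refl
-neg-linear .L-+ g h -[1+ n ] = ℚₚ.neg-distrib-+ (g -[1+ n ]) (h -[1+ n ])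
-neg-linear .L-* c g e        = trans (cong -_ (neg-* c g e)) (ℚₚ.neg-distribʳ-* c (neg g e))

join-linear : Linear join
join-linear = ∘-linear mulX-linear nonneg-linear

cut-linear : Linear cut
cut-linear = ∘-linear mulX-linear -neg-linear

-- X - XP = XQ. A refinement chooses at each gap inside a block whether to merge (X) or to separate
-- (-XP); this adds the two choices.
mulX+cut≗join : ∀ g e → mulX g e + cut g e ≡ join g e
mulX+cut≗join g e = begin
  mulX g e + cut g e                       ≡⟨ mulX-linear .L-+ g (λ e → - neg g e) e ⟨
  mulX (λ e → g e + - neg g e) e           ≡⟨ mulX-cong split e ⟩
  join g e                                 ∎
  where
  split : ∀ e → g e + - neg g e ≡ nonneg g e
  split (+ n)    = ℚₚ.+-identityʳ (g (+ n))
  split -[1+ n ] = ℚₚ.+-inverseʳ (g -[1+ n ])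

join^ : ℕ → Coeffs → Coeffs
join^ zero    g = g
join^ (suc n) g = join (join^ n g)

join^-linear : ∀ n → Linear (join^ n)
join^-linear zero    .L-cong eq  = eq
join^-linear zero    .L-+ _ _ _  = refl
join^-linear zero    .L-* _ _ _  = refl
join^-linear (suc n)             = ∘-linear join-linear (join^-linear n)

-- Sums over refinements and over admissible sets

∑-allBits : ∀ (f : List Bool → ℚ) n →
            ∑ f (allBits (suc n)) ≡ ∑ (λ T → f (false ∷ T) + f (true ∷ T)) (allBits n)
∑-allBits f n = trans (∑-concatMap f _ (allBits n))
  (∑-cong (λ T → +-congˡ (f (false ∷ T)) (ℚₚ.+-identityʳ (f (true ∷ T)))) (allBits n))

∑-swap : {A B : Set} (f : A → B → ℚ) → ∀ xs ys →
         ∑ (λ x → ∑ (f x) ys) xs ≡ ∑ (λ y → ∑ (λ x → f x y) xs) ys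
∑-swap f []       []       = refl
∑-swap f []       (y ∷ ys) = trans (∑-swap f [] ys) (sym (ℚₚ.+-identityˡ _))
∑-swap f (x ∷ xs) ys       = trans (+-congˡ (∑ (f x) ys) (∑-swap f xs ys))
  (sym (∑-+ (f x) (λ y → ∑ (λ x → f x y) xs) ys))

-- Displays the first part as a successor, the form that `𝒦M-1∷` and `𝒦L-1∷-cut` ask for.
compGo-∷ : ∀ c T → ∃ λ b → ∃ λ α → compGo (suc c) T ≡ suc b ∷ α
compGo-∷ c []          = c , [] , refl
compGo-∷ c (true  ∷ T) = c , compGo 1 T , refl
compGo-∷ c (false ∷ T) = compGo-∷ (suc c) T

-- A larger initial counter enlarges only the first part, wherever in `T` that part ends.
𝒦M-compGo : ∀ c T γ →
  coeff (𝒦M (compGo (suc (suc c)) T ++ γ)) ≗ mulX (coeff (𝒦M (compGo (suc c) T ++ γ)))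
𝒦M-compGo c []          γ = 𝒦M-suc (suc c) γ
𝒦M-compGo c (true  ∷ T) γ = 𝒦M-suc (suc c) (compGo 1 T ++ γ)
𝒦M-compGo c (false ∷ T) γ = 𝒦M-compGo (suc c) T γ

𝒦M-1∷bitsToComp : ∀ T γ →
  coeff (𝒦M (1 ∷ bitsToComp T ++ γ)) ≗ cut (coeff (𝒦M (bitsToComp T ++ γ)))
𝒦M-1∷bitsToComp T γ with bitsToComp T | compGo-∷ 0 T
... | _ | b , α , refl = 𝒦M-1∷ b (α ++ γ)

-- The first bit decides between merging and separating at the first gap, and by `mulX+cut≗join` the
-- two cases add up to `join`; n gaps give its n-th iterate. The suffix `γ` stands for the refined
-- later parts.
∑-𝒦M-bitsToComp : ∀ n γ e →
  ∑ (λ T → coeff (𝒦M (bitsToComp T ++ γ)) e) (allBits n) ≡ join^ n (coeff (𝒦M (1 ∷ γ))) e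
∑-𝒦M-bitsToComp zero    γ e = ℚₚ.+-identityʳ (coeff (𝒦M (1 ∷ γ)) e)
∑-𝒦M-bitsToComp (suc n) γ e = begin
  ∑ (λ T → coeff (𝒦M (bitsToComp T ++ γ)) e) (allBits (suc n))
    ≡⟨ ∑-allBits (λ T → coeff (𝒦M (bitsToComp T ++ γ)) e) n ⟩
  ∑ (λ T → coeff (𝒦M (compGo 2 T ++ γ)) e + coeff (𝒦M (1 ∷ bitsToComp T ++ γ)) e) (allBits n)
    ≡⟨ ∑-cong (λ T → trans (cong₂ _+_ (𝒦M-compGo 0 T γ e) (𝒦M-1∷bitsToComp T γ e))
                           (mulX+cut≗join (coeff (𝒦M (bitsToComp T ++ γ))) e)) (allBits n) ⟩
  ∑ (λ T → join (coeff (𝒦M (bitsToComp T ++ γ))) e) (allBits n)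
    ≡⟨ L-∑ join-linear (λ T → coeff (𝒦M (bitsToComp T ++ γ))) (allBits n) e ⟨
  join (λ e → ∑ (λ T → coeff (𝒦M (bitsToComp T ++ γ)) e) (allBits n)) e
    ≡⟨ join-linear .L-cong (∑-𝒦M-bitsToComp n γ) e ⟩
  join^ (suc n) (coeff (𝒦M (1 ∷ γ))) e ∎

∑-refinements : ∀ (f : List ℕ → ℚ) b β → ∑ f (refinements (suc b ∷ β)) ≡
                ∑ (λ T → ∑ (λ γ → f (bitsToComp T ++ γ)) (refinements β)) (allBits b)
∑-refinements f b β = begin
  ∑ f (refinements (suc b ∷ β))
    ≡⟨ ∑-concatMap f (λ α → map (α ++_) (refinements β)) (compositions (suc b)) ⟩
  ∑ (λ α → ∑ f (map (α ++_) (refinements β))) (compositions (suc b))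
    ≡⟨ ∑-map _ bitsToComp (allBits b) ⟩
  ∑ (λ T → ∑ f (map (bitsToComp T ++_) (refinements β))) (allBits b)
    ≡⟨ ∑-cong (λ T → ∑-map f (bitsToComp T ++_) (refinements β)) (allBits b) ⟩
  ∑ (λ T → ∑ (λ γ → f (bitsToComp T ++ γ)) (refinements β)) (allBits b) ∎

-- This is 𝒦(L) for the composition `1 ∷ β`, as a part 1 has no proper refinement; `join` is applied
-- to it when the first part grows.
𝒦L-1∷ : List ℕ → Coeffs
𝒦L-1∷ β e = ∑ (λ γ → coeff (𝒦M (1 ∷ γ)) e) (refinements β)

-- The first part is refined independently of the others, so after exchanging the sums the inner one
-- is `∑-𝒦M-bitsToComp`.
𝒦L-∷ : ∀ b β → coeff (𝒦L (suc b ∷ β)) ≗ join^ b (𝒦L-1∷ β)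
𝒦L-∷ b β e = begin
  coeff (𝒦L (suc b ∷ β)) e
    ≡⟨ coeff-concatMap 𝒦M (refinements (suc b ∷ β)) e ⟩
  ∑ (λ γ → coeff (𝒦M γ) e) (refinements (suc b ∷ β))
    ≡⟨ ∑-refinements (λ γ → coeff (𝒦M γ) e) b β ⟩
  ∑ (λ T → ∑ (λ γ → coeff (𝒦M (bitsToComp T ++ γ)) e) (refinements β)) (allBits b)
    ≡⟨ ∑-swap (λ T γ → coeff (𝒦M (bitsToComp T ++ γ)) e) (allBits b) (refinements β) ⟩
  ∑ (λ γ → ∑ (λ T → coeff (𝒦M (bitsToComp T ++ γ)) e) (allBits b)) (refinements β)
    ≡⟨ ∑-cong (λ γ → ∑-𝒦M-bitsToComp b γ e) (refinements β) ⟩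
  ∑ (λ γ → join^ b (coeff (𝒦M (1 ∷ γ))) e) (refinements β)
    ≡⟨ L-∑ (join^-linear b) (λ γ → coeff (𝒦M (1 ∷ γ))) (refinements β) e ⟨
  join^ b (𝒦L-1∷ β) e ∎

-- The new part 1 stays separate in every refinement, so each summand acquires a `cut`, which
-- linearity takes out of the sum.
𝒦L-1∷-cut : ∀ b β → 𝒦L-1∷ (suc b ∷ β) ≗ cut (coeff (𝒦L (suc b ∷ β)))
𝒦L-1∷-cut b β e = begin
  𝒦L-1∷ (suc b ∷ β) e
    ≡⟨ ∑-refinements (λ γ → coeff (𝒦M (1 ∷ γ)) e) b β ⟩
  ∑ (λ T → ∑ (λ γ → coeff (𝒦M (1 ∷ bitsToComp T ++ γ)) e) (refinements β)) (allBits b)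
    ≡⟨ ∑-cong (λ T → ∑-cong (λ γ → 𝒦M-1∷bitsToComp T γ e) (refinements β)) (allBits b) ⟩
  ∑ (λ T → ∑ (λ γ → cut (coeff (𝒦M (bitsToComp T ++ γ))) e) (refinements β)) (allBits b)
    ≡⟨ ∑-refinements (λ γ → cut (coeff (𝒦M γ)) e) b β ⟨
  ∑ (λ γ → cut (coeff (𝒦M γ)) e) (refinements (suc b ∷ β))
    ≡⟨ L-∑ cut-linear (λ γ → coeff (𝒦M γ)) (refinements (suc b ∷ β)) e ⟨
  cut (λ e → ∑ (λ γ → coeff (𝒦M γ) e) (refinements (suc b ∷ β))) e
    ≡⟨ cut-linear .L-cong (coeff-concatMap 𝒦M (refinements (suc b ∷ β))) e ⟨
  cut (coeff (𝒦L (suc b ∷ β))) e ∎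

𝒦L-compGo : ∀ c T → coeff (𝒦L (compGo (suc (suc c)) T)) ≗ join (coeff (𝒦L (compGo (suc c) T)))
𝒦L-compGo c []          e = trans (𝒦L-∷ (suc c) [] e) (sym (join-linear .L-cong (𝒦L-∷ c []) e))
𝒦L-compGo c (true  ∷ T) e =
  trans (𝒦L-∷ (suc c) (compGo 1 T) e) (sym (join-linear .L-cong (𝒦L-∷ c (compGo 1 T)) e))
𝒦L-compGo c (false ∷ T) e = 𝒦L-compGo (suc c) T e

-- Subsets and words read from left to right.

𝒦L-bits : List Bool → Coeffs
𝒦L-bits T = coeff (𝒦L (bitsToComp T))

𝒦L-bits-[] : 𝒦L-bits [] ≗ E 1ℤ
𝒦L-bits-[] e =
  trans (𝒦L-∷ 0 [] e) (trans (ℚₚ.+-identityʳ (coeff (𝒦M (1 ∷ [])) e)) (𝒦M-[1] e))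

𝒦L-bits-false : ∀ T → 𝒦L-bits (false ∷ T) ≗ join (𝒦L-bits T)
𝒦L-bits-false = 𝒦L-compGo 0

𝒦L-bits-true : ∀ T → 𝒦L-bits (true ∷ T) ≗ cut (𝒦L-bits T)
𝒦L-bits-true T with bitsToComp T | compGo-∷ 0 T
... | _ | b , β , refl = λ e → trans (𝒦L-∷ 0 (suc b ∷ β) e) (𝒦L-1∷-cut b β e)

-- A mark m computed from `acc` is at least acc + 2, so after the shift the tested positions m and m
-- + 1 are at least 2 and never reach the new bit.
admissible-shift : ∀ acc w b T →
  admissible (dMarksGo (suc acc) w) (b ∷ T) ≡ admissible (dMarksGo acc w) T
admissible-shift acc []      b T = refl
admissible-shift acc (𝐜 ∷ w) b T = admissible-shift (suc acc) w b T
admissible-shift acc (𝐝 ∷ w) b T rewrite ℕₚ.+-comm acc 2 =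
  cong (meetsBoth T (suc (suc acc)) ∧_) (admissible-shift (suc (suc acc)) w b T)

-- The filter of `Ξ` becomes a conditional summand over all bit lists, a form in which linear
-- operators pass through the sum.
𝒦Θ : List Letter → Coeffs
𝒦Θ w e = ∑ (λ T → if admissible (dMarks w) T then 𝒦L-bits T e else 0ℚ) (allBits (deg w))

coeff-Ξ : ∀ w → coeff (Ξ w) ≗ 𝒦Θ w
coeff-Ξ w e = trans
  (coeff-concatMap (λ T → 𝒦L (bitsToComp T)) (filterB (admissible (dMarks w)) (allBits (deg w))) e)
  (∑-filterB (admissible (dMarks w)) (λ T → 𝒦L-bits T e) (allBits (deg w)))

when : Bool → Coeffs → Coeffs
when b g e = if b then g e else 0ℚ

when-cong : ∀ {b b′ g h} → b ≡ b′ → g ≗ h → when b g ≗ when b′ h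
when-cong {true}  refl g≗h e = g≗h e
when-cong {false} refl g≗h e = refl

𝒦Θ-linear : ∀ {L} → Linear L → ∀ w e →
  ∑ (λ T → when (admissible (dMarks w) T) (L (𝒦L-bits T)) e) (allBits (deg w)) ≡ L (𝒦Θ w) e
𝒦Θ-linear l w e = sym (trans
  (L-∑ l (λ T → when (admissible (dMarks w) T) (𝒦L-bits T)) (allBits (deg w)) e)
  (∑-cong (λ T → L-if l (admissible (dMarks w) T) (𝒦L-bits T) e) (allBits (deg w))))

c-op d-op : Coeffs → Coeffs
c-op g e = join g e + cut g e
d-op g e = join (cut g) e + cut (join g) e

c-op-linear : Linear c-op
c-op-linear = +-linear join-linear cut-linear

d-op-linear : Linear d-op
d-op-linear = +-linear (∘-linear join-linear cut-linear) (∘-linear cut-linear join-linear)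

𝒦Θ-𝐜 : ∀ w → 𝒦Θ (𝐜 ∷ w) ≗ c-op (𝒦Θ w)
𝒦Θ-𝐜 w e = begin
  𝒦Θ (𝐜 ∷ w) e
    ≡⟨ ∑-allBits _ (deg w) ⟩
  ∑ (λ T → when (admissible (dMarksGo 1 w) (false ∷ T)) (𝒦L-bits (false ∷ T)) e
         + when (admissible (dMarksGo 1 w) (true  ∷ T)) (𝒦L-bits (true  ∷ T)) e) (allBits (deg w))
    ≡⟨ ∑-cong (λ T → cong₂ _+_
         (when-cong (admissible-shift 0 w false T) (𝒦L-bits-false T) e)
         (when-cong (admissible-shift 0 w true  T) (𝒦L-bits-true  T) e)) (allBits (deg w)) ⟩
  ∑ (λ T → when (admissible (dMarks w) T) (join (𝒦L-bits T)) e
         + when (admissible (dMarks w) T) (cut  (𝒦L-bits T)) e) (allBits (deg w))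
    ≡⟨ ∑-+ _ _ (allBits (deg w)) ⟩
  ∑ (λ T → when (admissible (dMarks w) T) (join (𝒦L-bits T)) e) (allBits (deg w))
  + ∑ (λ T → when (admissible (dMarks w) T) (cut (𝒦L-bits T)) e) (allBits (deg w))
    ≡⟨ cong₂ _+_ (𝒦Θ-linear join-linear w e) (𝒦Θ-linear cut-linear w e) ⟩
  c-op (𝒦Θ w) e ∎

𝒦Θ-𝐝 : ∀ w → 𝒦Θ (𝐝 ∷ w) ≗ d-op (𝒦Θ w)
𝒦Θ-𝐝 w e = begin
  𝒦Θ (𝐝 ∷ w) e
    ≡⟨ trans (∑-allBits _ (suc (deg w))) (∑-allBits _ (deg w)) ⟩
  -- Mark 2 tests the first two bits: equal bits are rejected by computation and leave the two
  -- zeros.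
  ∑ (λ T → (0ℚ + when (adm true false T) (𝒦L-bits (true ∷ false ∷ T)) e)
         + (when (adm false true T) (𝒦L-bits (false ∷ true ∷ T)) e + 0ℚ)) (allBits (deg w))
    ≡⟨ ∑-cong (λ T → trans (tidy (when (adm true false T) (𝒦L-bits (true ∷ false ∷ T)) e)
                                   (when (adm false true T) (𝒦L-bits (false ∷ true ∷ T)) e)) (cong₂ _+_
         (when-cong (adm-shift false true T)
            (λ e → trans (𝒦L-bits-false (true ∷ T) e) (join-linear .L-cong (𝒦L-bits-true T) e)) e)
         (when-cong (adm-shift true false T)
            (λ e → trans (𝒦L-bits-true (false ∷ T) e) (cut-linear .L-cong (𝒦L-bits-false T) e)) e)))
         (allBits (deg w)) ⟩
  ∑ (λ T → when (admissible (dMarks w) T) (join (cut (𝒦L-bits T))) e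
         + when (admissible (dMarks w) T) (cut (join (𝒦L-bits T))) e) (allBits (deg w))
    ≡⟨ ∑-+ _ _ (allBits (deg w)) ⟩
  ∑ (λ T → when (admissible (dMarks w) T) (join (cut (𝒦L-bits T))) e) (allBits (deg w))
  + ∑ (λ T → when (admissible (dMarks w) T) (cut (join (𝒦L-bits T))) e) (allBits (deg w))
    ≡⟨ cong₂ _+_ (𝒦Θ-linear (∘-linear join-linear cut-linear) w e)
                 (𝒦Θ-linear (∘-linear cut-linear join-linear) w e) ⟩
  d-op (𝒦Θ w) e ∎
  where
  adm : Bool → Bool → List Bool → Bool
  adm a b T = admissible (dMarksGo 2 w) (a ∷ b ∷ T)
  adm-shift : ∀ a b T → adm a b T ≡ admissible (dMarks w) T
  adm-shift a b T = trans (admissible-shift 1 w a (b ∷ T)) (admissible-shift 0 w b T)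
  tidy : ∀ x y → (0ℚ + x) + (y + 0ℚ) ≡ y + x
  tidy = ring-∀ ℚ-ring

-- The operators of 𝐜 and 𝐝 on the antisymmetric polynomials E_m

c-op≗mulX : ∀ g → c-op g ≗ mulX (λ e → nonneg g e + - neg g e)
c-op≗mulX g e = sym (mulX-linear .L-+ (nonneg g) (λ e → - neg g e) e)

-- For m ≥ 1, Q - P keeps -z^m and reverses the sign of z^(-m), which turns the antisymmetric E_m
-- into a symmetric polynomial.
E-reflect : ∀ k e → nonneg (E (+ suc k)) e + - neg (E (+ suc k)) e ≡
            - (δ (e ℤ.+ + suc k) + δ (e ℤ.- + suc k))
E-reflect k (+ n) = begin
  (δ (+ (n ℕ.+ suc k)) - y) + - 0ℚ   ≡⟨ cong (λ x → (x - y) + - 0ℚ) off ⟩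
  (0ℚ - y) + - 0ℚ                    ≡⟨ tidy y ⟩
  - (0ℚ + y)                         ≡⟨ cong (λ x → - (x + y)) off ⟨
  - (δ (+ (n ℕ.+ suc k)) + y)        ∎
  where
  y = δ (+ n ℤ.- + suc k)
  off : δ (+ (n ℕ.+ suc k)) ≡ 0ℚ
  off = cong (δ ∘ +_) (ℕₚ.+-suc n k)
  tidy : ∀ y → (0ℚ - y) + - 0ℚ ≡ - (0ℚ + y)
  tidy = ring-∀ ℚ-ring
E-reflect k -[1+ n ] = tidy (δ (-[1+ n ] ℤ.+ + suc k))
  where
  tidy : ∀ x → 0ℚ + - (x - 0ℚ) ≡ - (x + 0ℚ)
  tidy = ring-∀ ℚ-ring

-- After `E-reflect` this is the expansion of -X(z^m + z^(-m)). Positivity of m enters as an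
-- equation because `μ n i` does not reduce to a successor.
c-op-E : ∀ k {m} → m ≡ + suc k → ∀ e → c-op (E m) e ≡ E (m ℤ.+ 1ℤ) e - E (m ℤ.- 1ℤ) e
c-op-E k {m} refl e = begin
  c-op (E m) e
    ≡⟨ c-op≗mulX (E m) e ⟩
  mulX (λ e → nonneg (E m) e + - neg (E m) e) e
    ≡⟨ mulX-cong (E-reflect k) e ⟩
  - (δ (e ℤ.- 1ℤ ℤ.+ m) + δ (e ℤ.- 1ℤ ℤ.- m)) - - (δ (e ℤ.+ 1ℤ ℤ.+ m) + δ (e ℤ.+ 1ℤ ℤ.- m))
    ≡⟨ cong₂ _-_ (cong₂ (λ x y → - (δ x + δ y)) (s₁ e m) (s₂ e m))
                 (cong₂ (λ x y → - (δ x + δ y)) (s₃ e m) (s₄ e m)) ⟩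
  - (b + c) - - (a + d)
    ≡⟨ tidy a b c d ⟩
  (a - c) - (b - d) ∎
  where
  a = δ (e ℤ.+ (m ℤ.+ 1ℤ))
  b = δ (e ℤ.+ (m ℤ.- 1ℤ))
  c = δ (e ℤ.- (m ℤ.+ 1ℤ))
  d = δ (e ℤ.- (m ℤ.- 1ℤ))
  s₁ : ∀ e m → e ℤ.- 1ℤ ℤ.+ m ≡ e ℤ.+ (m ℤ.- 1ℤ)
  s₁ = ℤ-Solver.solve-∀
  s₂ : ∀ e m → e ℤ.- 1ℤ ℤ.- m ≡ e ℤ.- (m ℤ.+ 1ℤ)
  s₂ = ℤ-Solver.solve-∀
  s₃ : ∀ e m → e ℤ.+ 1ℤ ℤ.+ m ≡ e ℤ.+ (m ℤ.+ 1ℤ)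
  s₃ = ℤ-Solver.solve-∀
  s₄ : ∀ e m → e ℤ.+ 1ℤ ℤ.- m ≡ e ℤ.- (m ℤ.- 1ℤ)
  s₄ = ℤ-Solver.solve-∀
  tidy : ∀ a b c d → - (b + c) - - (a + d) ≡ (a - c) - (b - d)
  tidy = ring-∀ ℚ-ring

E-at-0 : ∀ m → E m 0ℤ ≡ 0ℚ
E-at-0 (+ zero)  = refl
E-at-0 (+ suc n) = refl
E-at-0 -[1+ n ]  = refl

E-0 : ∀ e → E 0ℤ e ≡ 0ℚ
E-0 e = ℚₚ.+-inverseʳ (δ (e ℤ.+ 0ℤ))

-- X moves exponents by one, so the only nonnegative power in X(Pg) is the constant term g₋₁, and
-- the only negative one in X(Qg) is -g₀z⁻¹, which the hypothesis removes. What is left is -g₋₁X =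
-- g₋₁E₁. A 𝐝 thus retains a single number of all that follows it, whence the product formula.
d-op-E : ∀ g → g 0ℤ ≡ 0ℚ → d-op g ≗ λ e → g -[1+ 0 ] * E 1ℤ e
d-op-E g g0≡0 e = begin
  join (cut g) e + cut (join g) e
    ≡⟨ cong₂ _+_ (mulX-cong nonneg-cut e) (mulX-cong neg-join e) ⟩
  mulX (λ e → - a * δ e) e + (0ℚ - 0ℚ)
    ≡⟨ tidy a (δ (e ℤ.- 1ℤ)) (δ (e ℤ.+ 1ℤ)) ⟩
  a * E 1ℤ e ∎
  where
  a = g -[1+ 0 ]
  tidy : ∀ a x y → (- a * x - - a * y) + (0ℚ - 0ℚ) ≡ a * (y - x)
  tidy = ring-∀ ℚ-ring
  at-0 : ∀ a → - a - - 0ℚ ≡ - a * 1ℚ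
  at-0 = ring-∀ ℚ-ring
  nonneg-cut : ∀ e → nonneg (cut g) e ≡ - a * δ e
  nonneg-cut (+ zero)  = at-0 a
  nonneg-cut (+ suc n) = sym (ℚₚ.*-zeroʳ (- a))
  nonneg-cut -[1+ n ]  = sym (ℚₚ.*-zeroʳ (- a))
  neg-join : ∀ e → - neg (join g) e ≡ 0ℚ
  neg-join (+ n)        = refl
  neg-join -[1+ zero ]  = cong (λ x → - (0ℚ - x)) g0≡0
  neg-join -[1+ suc n ] = refl

-- Ballot numbers

-- C(n, i-1) with the value 0 at i = 0, where `n C (i ∸ 1)` would be 1.
C-pred : ℕ → ℕ → ℕ
C-pred n zero    = 0
C-pred n (suc i) = n C i

pascal : ∀ n i → C-pred n i ℕ.+ n C i ≡ suc n C i
pascal n zero    = refl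
pascal n (suc i) = nCk+nC[k+1]≡[n+1]C[k+1] n i

-- Induction on n: Pascal's rule splits the upper binomial coefficient and reassembles the lower
-- one.
absorption : ∀ n i → i ℕ.* (suc n C i) ≡ suc n ℕ.* C-pred n i
absorption n       zero          = sym (ℕₚ.*-zeroʳ n)
absorption zero    (suc zero)    = refl
absorption zero    (suc (suc i)) = begin
  suc (suc i) ℕ.* (1 C suc (suc i))  ≡⟨ cong (suc (suc i) ℕ.*_) (k>n⇒nCk≡0 {1} {suc (suc i)} (ℕ.s≤s (ℕ.s≤s ℕ.z≤n))) ⟩
  suc (suc i) ℕ.* 0                  ≡⟨ ℕₚ.*-zeroʳ i ⟩
  0                                  ≡⟨ cong (ℕ._+ 0) (k>n⇒nCk≡0 {0} {suc i} (ℕ.s≤s ℕ.z≤n)) ⟨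
  1 ℕ.* (0 C suc i)                  ∎
absorption (suc n) (suc i) = begin
  suc i ℕ.* (suc (suc n) C suc i)
    ≡⟨ cong (suc i ℕ.*_) (pascal (suc n) (suc i)) ⟨
  suc i ℕ.* (c ℕ.+ (suc n C suc i))
    ≡⟨ ℕₚ.*-distribˡ-+ (suc i) c (suc n C suc i) ⟩
  suc i ℕ.* c ℕ.+ suc i ℕ.* (suc n C suc i)
    ≡⟨ cong (suc i ℕ.* c ℕ.+_) (absorption n (suc i)) ⟩
  c ℕ.+ i ℕ.* c ℕ.+ suc n ℕ.* (n C i)
    ≡⟨ cong (λ x → c ℕ.+ x ℕ.+ suc n ℕ.* (n C i)) (absorption n i) ⟩
  c ℕ.+ suc n ℕ.* C-pred n i ℕ.+ suc n ℕ.* (n C i)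
    ≡⟨ ℕₚ.+-assoc c (suc n ℕ.* C-pred n i) (suc n ℕ.* (n C i)) ⟩
  c ℕ.+ (suc n ℕ.* C-pred n i ℕ.+ suc n ℕ.* (n C i))
    ≡⟨ cong (c ℕ.+_) (ℕₚ.*-distribˡ-+ (suc n) (C-pred n i) (n C i)) ⟨
  c ℕ.+ suc n ℕ.* (C-pred n i ℕ.+ n C i)
    ≡⟨ cong (λ x → c ℕ.+ suc n ℕ.* x) (pascal n i) ⟩
  suc (suc n) ℕ.* c ∎
  where
  c = suc n C i

-- Denominator-free form of b(n,i) = C(n,i) - C(n,i-1); the bound makes the truncated subtraction
-- exact.
ballot-numerator : ∀ n i → 2 ℕ.* i ℕ.≤ suc n →
  (suc n ∸ 2 ℕ.* i) ℕ.* (suc n C i) ℕ.+ suc n ℕ.* C-pred n i ≡ suc n ℕ.* (n C i)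
ballot-numerator n i 2i≤1+n = begin
  d ℕ.* c ℕ.+ suc n ℕ.* C-pred n i
    ≡⟨ cong (d ℕ.* c ℕ.+_) (absorption n i) ⟨
  d ℕ.* c ℕ.+ i ℕ.* c
    -- Adding i·c once more produces the factor d + 2i = n + 1, after which Pascal's rule and
    -- absorption finish.
    ≡⟨ ℕₚ.+-cancelʳ-≡ (i ℕ.* c) _ _ cancelled ⟩
  suc n ℕ.* (n C i) ∎
  where
  c = suc n C i
  d = suc n ∸ 2 ℕ.* i
  regroup : ∀ d i c → d ℕ.* c ℕ.+ i ℕ.* c ℕ.+ i ℕ.* c ≡ (d ℕ.+ 2 ℕ.* i) ℕ.* c
  regroup = ℕ-Solver.solve-∀
  cancelled : d ℕ.* c ℕ.+ i ℕ.* c ℕ.+ i ℕ.* c ≡ suc n ℕ.* (n C i) ℕ.+ i ℕ.* c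
  cancelled = begin
    d ℕ.* c ℕ.+ i ℕ.* c ℕ.+ i ℕ.* c                  ≡⟨ regroup d i c ⟩
    (d ℕ.+ 2 ℕ.* i) ℕ.* c                            ≡⟨ cong (ℕ._* c) (ℕₚ.m∸n+n≡m 2i≤1+n) ⟩
    suc n ℕ.* c                                      ≡⟨ cong (suc n ℕ.*_) (pascal n i) ⟨
    suc n ℕ.* (C-pred n i ℕ.+ n C i)                 ≡⟨ cong (suc n ℕ.*_) (ℕₚ.+-comm (C-pred n i) (n C i)) ⟩
    suc n ℕ.* (n C i ℕ.+ C-pred n i)                 ≡⟨ ℕₚ.*-distribˡ-+ (suc n) (n C i) (C-pred n i) ⟩
    suc n ℕ.* (n C i) ℕ.+ suc n ℕ.* C-pred n i       ≡⟨ cong (suc n ℕ.* (n C i) ℕ.+_) (absorption n i) ⟨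
    suc n ℕ.* (n C i) ℕ.+ i ℕ.* c                    ∎

ι : ℕ → ℚ
ι n = + n ℚ./ 1

-- Division in ℚ reduces to lowest terms and does not compute on variables, so the comparison is
-- made among unnormalised fractions, by cross multiplication.
/-+ι : ∀ k a b c → a ℕ.+ suc k ℕ.* b ≡ suc k ℕ.* c → + a ℚ./ suc k + ι b ≡ ι c
/-+ι k a b c eq = ℚₚ.toℚᵘ-injective $ ℚᵘₚ.≃-trans
  (ℚₚ.toℚᵘ-homo-+ (+ a ℚ./ suc k) (ι b))
  (ℚᵘₚ.≃-trans
    (ℚᵘₚ.+-cong (ℚₚ.toℚᵘ-fromℚᵘ (mkℚᵘ (+ a) k)) (ℚₚ.toℚᵘ-fromℚᵘ (mkℚᵘ (+ b) 0)))
    (ℚᵘₚ.≃-trans (*≡* numerators) (ℚᵘₚ.≃-sym (ℚₚ.toℚᵘ-fromℚᵘ (mkℚᵘ (+ c) 0)))))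
  where
  clear : ∀ a b k → (a ℤ.* 1ℤ ℤ.+ b ℤ.* k) ℤ.* 1ℤ ≡ a ℤ.+ k ℤ.* b
  clear = ℤ-Solver.solve-∀
  numerators : (+ a ℤ.* 1ℤ ℤ.+ + b ℤ.* + suc k) ℤ.* 1ℤ ≡ + c ℤ.* + (suc k ℕ.* 1)
  numerators = begin
    (+ a ℤ.* 1ℤ ℤ.+ + b ℤ.* + suc k) ℤ.* 1ℤ  ≡⟨ clear (+ a) (+ b) (+ suc k) ⟩
    + a ℤ.+ + suc k ℤ.* + b                  ≡⟨ cong (ℤ._+_ (+ a)) (ℤₚ.pos-* (suc k) b) ⟨
    + (a ℕ.+ suc k ℕ.* b)                    ≡⟨ cong +_ eq ⟩
    + (suc k ℕ.* c)                          ≡⟨ ℤₚ.pos-* (suc k) c ⟩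
    + suc k ℤ.* + c                          ≡⟨ ℤₚ.*-comm (+ suc k) (+ c) ⟩
    + c ℤ.* + suc k                          ≡⟨ cong (λ x → + c ℤ.* + x) (ℕₚ.*-identityʳ (suc k)) ⟨
    + c ℤ.* + (suc k ℕ.* 1)                  ∎

ι-+ : ∀ a b → ι a + ι b ≡ ι (a ℕ.+ b)
ι-+ a b = /-+ι 0 a b (a ℕ.+ b) (shape a b)
  where
  shape : ∀ a b → a ℕ.+ 1 ℕ.* b ≡ 1 ℕ.* (a ℕ.+ b)
  shape = ℕ-Solver.solve-∀

-- In this form the ballot recurrence becomes Pascal's rule. The range includes 2i = n + 1, where
-- both sides are 0; `ballotCoeff-suc` reaches that boundary.
ballotCoeff-diff : ∀ n i → 2 ℕ.* i ℕ.≤ suc n → ballotCoeff n i ≡ ι (n C i) - ι (C-pred n i)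
ballotCoeff-diff n i 2i≤1+n = begin
  b                          ≡⟨ expand b (ι (C-pred n i)) ⟩
  (b + ι (C-pred n i)) - ι (C-pred n i)
    ≡⟨ cong (_- ι (C-pred n i)) (/-+ι n (((n ℕ.+ 1) ∸ 2 ℕ.* i) ℕ.* ((n ℕ.+ 1) C i)) (C-pred n i) (n C i) numerator) ⟩
  ι (n C i) - ι (C-pred n i) ∎
  where
  b = ballotCoeff n i
  expand : ∀ x y → x ≡ (x + y) - y
  expand = ring-∀ ℚ-ring
  numerator : ((n ℕ.+ 1) ∸ 2 ℕ.* i) ℕ.* ((n ℕ.+ 1) C i) ℕ.+ suc n ℕ.* C-pred n i ≡ suc n ℕ.* (n C i)
  numerator rewrite ℕₚ.+-comm n 1 = ballot-numerator n i 2i≤1+n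

ballotCoeff-0 : ∀ n i → n ℕ.< 2 ℕ.* i → ballotCoeff n i ≡ 0ℚ
ballotCoeff-0 n i n<2i = trans
  (cong (λ d → + (d ℕ.* ((n ℕ.+ 1) C i)) ℚ./ suc n)
    (ℕₚ.m≤n⇒m∸n≡0 (subst (ℕ._≤ 2 ℕ.* i) (ℕₚ.+-comm 1 n) n<2i)))
  (ℚₚ.0/n≡0 (suc n))

ballotCoeff-suc : ∀ n i → 2 ℕ.* i ℕ.< n →
  ballotCoeff (suc n) (suc i) ≡ ballotCoeff n (suc i) + ballotCoeff n i
ballotCoeff-suc n i 2i<n = begin
  ballotCoeff (suc n) (suc i)
    ≡⟨ ballotCoeff-diff (suc n) (suc i) (ℕₚ.m≤n⇒m≤1+n 2+2i≤1+n) ⟩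
  ι (suc n C suc i) - ι (suc n C i)
    ≡⟨ cong₂ (λ x y → ι x - ι y) (pascal n (suc i)) (pascal n i) ⟨
  ι (n C i ℕ.+ n C suc i) - ι (C-pred n i ℕ.+ n C i)
    ≡⟨ cong₂ _-_ (ι-+ (n C i) (n C suc i)) (ι-+ (C-pred n i) (n C i)) ⟨
  (ι (n C i) + ι (n C suc i)) - (ι (C-pred n i) + ι (n C i))
    ≡⟨ regroup (ι (n C i)) (ι (n C suc i)) (ι (C-pred n i)) ⟩
  (ι (n C suc i) - ι (n C i)) + (ι (n C i) - ι (C-pred n i))
    ≡⟨ cong₂ _+_ (ballotCoeff-diff n (suc i) 2+2i≤1+n)
                 (ballotCoeff-diff n i (ℕₚ.m≤n⇒m≤1+n (ℕₚ.<⇒≤ 2i<n))) ⟨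
  ballotCoeff n (suc i) + ballotCoeff n i ∎
  where
  2+2i≤1+n : 2 ℕ.* suc i ℕ.≤ suc n
  2+2i≤1+n = subst (ℕ._≤ suc n) (sym (ℕₚ.*-suc 2 i)) (ℕ.s≤s 2i<n)
  regroup : ∀ x y z → (x + y) - (z + x) ≡ (y - x) + (x - z)
  regroup = ring-∀ ℚ-ring

-- U n = Σ_i v n i · E (μ n i); the terms with 2i > n vanish because ballotCoeff n i does
-- (its subtraction is truncated).
v : ℕ → ℕ → ℚ
v n i = signℚ i * ballotCoeff n i

v-0 : ∀ n i → n ℕ.< 2 ℕ.* i → v n i ≡ 0ℚ
v-0 n i n<2i = trans (cong (signℚ i *_) (ballotCoeff-0 n i n<2i)) (ℚₚ.*-zeroʳ (signℚ i))

μ : ℕ → ℕ → ℤ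
μ n i = + (n ℕ.+ 1) ℤ.- + (2 ℕ.* i)

μ-suc : ∀ n i → μ (suc n) i ≡ μ n i ℤ.+ 1ℤ
μ-suc n i = shape (+ (n ℕ.+ 1)) (+ (2 ℕ.* i))
  where
  shape : ∀ x y → 1ℤ ℤ.+ x ℤ.- y ≡ x ℤ.- y ℤ.+ 1ℤ
  shape = ℤ-Solver.solve-∀

μ-suc-suc : ∀ n i → μ (suc n) (suc i) ≡ μ n i ℤ.- 1ℤ
μ-suc-suc n i = trans (cong (λ x → + (suc n ℕ.+ 1) ℤ.- + x) (ℕₚ.*-suc 2 i))
                      (shape (+ (n ℕ.+ 1)) (+ (2 ℕ.* i)))
  where
  shape : ∀ x y → 1ℤ ℤ.+ x ℤ.- (+ 2 ℤ.+ y) ≡ x ℤ.- y ℤ.- 1ℤ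
  shape = ℤ-Solver.solve-∀

μ≡ : ∀ {n i k} → n ≡ k ℕ.+ 2 ℕ.* i → μ n i ≡ + suc k
μ≡ {i = i} {k} refl = trans (cong (λ x → + x ℤ.- + (2 ℕ.* i)) (ℕₚ.+-comm (k ℕ.+ 2 ℕ.* i) 1))
                            (cancel (+ suc k) (+ (2 ℕ.* i)))
  where
  cancel : ∀ x y → x ℤ.+ y ℤ.- y ≡ x
  cancel = ℤ-Solver.solve-∀

μ-≤ : ∀ n i → 2 ℕ.* i ℕ.≤ n → μ n i ≡ + suc (n ∸ 2 ℕ.* i)
μ-≤ n i 2i≤n = μ≡ {n} {i} (sym (ℕₚ.m∸n+n≡m 2i≤n))

-- At 2i = n the ballot recurrence fails, but there μ (suc n) (suc i) = 0 and E 0 = 0.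
v-recurrence : ∀ n i e → v (suc n) (suc i) * E (μ (suc n) (suc i)) e ≡
  v n (suc i) * E (μ (suc n) (suc i)) e - v n i * E (μ (suc n) (suc i)) e
v-recurrence n i e = compare (ℕₚ.<-cmp (2 ℕ.* i) n)
  where
  s = signℚ i
  x = E (μ (suc n) (suc i)) e
  distrib : ∀ s a b x → - s * (a + b) * x ≡ - s * a * x - s * b * x
  distrib = ring-∀ ℚ-ring
  tidy-μ : ∀ a b c → a * 0ℚ ≡ b * 0ℚ - c * 0ℚ
  tidy-μ = ring-∀ ℚ-ring
  tidy-v : ∀ x → 0ℚ * x ≡ 0ℚ * x - 0ℚ * x
  tidy-v = ring-∀ ℚ-ring
  compare : Tri (2 ℕ.* i ℕ.< n) (2 ℕ.* i ≡ n) (n ℕ.< 2 ℕ.* i) →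
            v (suc n) (suc i) * x ≡ v n (suc i) * x - v n i * x
  compare (tri< 2i<n _ _) = begin
    - s * ballotCoeff (suc n) (suc i) * x
      ≡⟨ cong (λ b → - s * b * x) (ballotCoeff-suc n i 2i<n) ⟩
    - s * (ballotCoeff n (suc i) + ballotCoeff n i) * x
      ≡⟨ distrib s (ballotCoeff n (suc i)) (ballotCoeff n i) x ⟩
    - s * ballotCoeff n (suc i) * x - s * ballotCoeff n i * x ∎
  compare (tri≈ _ 2i≡n _) = begin
    v (suc n) (suc i) * x                      ≡⟨ cong (v (suc n) (suc i) *_) x≡0 ⟩
    v (suc n) (suc i) * 0ℚ                     ≡⟨ tidy-μ (v (suc n) (suc i)) (v n (suc i)) (v n i) ⟩
    v n (suc i) * 0ℚ - v n i * 0ℚ              ≡⟨ cong (λ x → v n (suc i) * x - v n i * x) x≡0 ⟨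
    v n (suc i) * x - v n i * x                ∎
    where
    μ≡0 : μ (suc n) (suc i) ≡ 0ℤ
    μ≡0 = trans (μ-suc-suc n i) (cong (ℤ._- 1ℤ) (μ≡ {n} {i} {0} (sym 2i≡n)))
    x≡0 : x ≡ 0ℚ
    x≡0 = trans (cong (λ m → E m e) μ≡0) (E-0 e)
  compare (tri> _ _ n<2i) = begin
    v (suc n) (suc i) * x           ≡⟨ cong (_* x) (v-0 (suc n) (suc i) 1+n<2+2i) ⟩
    0ℚ * x                          ≡⟨ tidy-v x ⟩
    0ℚ * x - 0ℚ * x                 ≡⟨ cong₂ (λ a b → a * x - b * x) (v-0 n (suc i) n<2+2i) (v-0 n i n<2i) ⟨
    v n (suc i) * x - v n i * x     ∎
    where
    n<2+2i : n ℕ.< 2 ℕ.* suc i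
    n<2+2i = ℕₚ.<-≤-trans n<2i (ℕₚ.*-monoʳ-≤ 2 (ℕₚ.n≤1+n i))
    1+n<2+2i : suc n ℕ.< 2 ℕ.* suc i
    1+n<2+2i = subst (suc n ℕ.<_) (sym (ℕₚ.*-suc 2 i)) (ℕ.s≤s (ℕₚ.m≤n⇒m≤1+n n<2i))

-- Shifted sums and the polynomials U_n.

∑-last : ∀ (f : ℕ → ℚ) (h : ℕ → ℕ) n →
         ∑ f (applyUpTo h (suc n)) ≡ ∑ f (applyUpTo h n) + f (h n)
∑-last f h zero    = ℚₚ.+-comm (f (h 0)) 0ℚ
∑-last f h (suc n) = trans (+-congˡ (f (h 0)) (∑-last f (h ∘ suc) n))
  (sym (ℚₚ.+-assoc (f (h 0)) (∑ f (applyUpTo (h ∘ suc) n)) (f (h (suc n)))))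

∑-extend : ∀ {f M} → (∀ i → M ℕ.≤ i → f i ≡ 0ℚ) → ∀ k → ∑ f (upTo (k ℕ.+ M)) ≡ ∑ f (upTo M)
∑-extend         f≡0 zero    = refl
∑-extend {f} {M} f≡0 (suc k) = begin
  ∑ f (upTo (suc (k ℕ.+ M)))             ≡⟨ ∑-last f id (k ℕ.+ M) ⟩
  ∑ f (upTo (k ℕ.+ M)) + f (k ℕ.+ M)     ≡⟨ cong₂ _+_ (∑-extend f≡0 k) (f≡0 (k ℕ.+ M) (ℕₚ.m≤n+m M k)) ⟩
  ∑ f (upTo M) + 0ℚ                      ≡⟨ ℚₚ.+-identityʳ (∑ f (upTo M)) ⟩
  ∑ f (upTo M)                           ∎

-- Reindexing: `b i` enters on the left at index i + 1 and on the right at index i, which leaves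
-- `a N` without a partner.
∑-telescope : ∀ (a b t : ℕ → ℚ) → t 0 ≡ a 0 → (∀ i → t (suc i) ≡ a (suc i) - b i) → ∀ N →
              ∑ t (upTo (suc N)) ≡ ∑ (λ i → a i - b i) (upTo N) + a N
∑-telescope a b t t₀ tₛ zero    = trans (+-comm-0 (t 0)) (+-congˡ 0ℚ t₀)
  where
  +-comm-0 : ∀ x → x + 0ℚ ≡ 0ℚ + x
  +-comm-0 = ring-∀ ℚ-ring
∑-telescope a b t t₀ tₛ (suc N) = begin
  ∑ t (upTo (suc (suc N)))
    ≡⟨ ∑-last t id (suc N) ⟩
  ∑ t (upTo (suc N)) + t (suc N)
    ≡⟨ cong₂ _+_ (∑-telescope a b t t₀ tₛ N) (tₛ N) ⟩
  (∑ (λ i → a i - b i) (upTo N) + a N) + (a (suc N) - b N)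
    ≡⟨ regroup (∑ (λ i → a i - b i) (upTo N)) (a N) (a (suc N)) (b N) ⟩
  (∑ (λ i → a i - b i) (upTo N) + (a N - b N)) + a (suc N)
    ≡⟨ cong (_+ a (suc N)) (∑-last (λ i → a i - b i) id N) ⟨
  ∑ (λ i → a i - b i) (upTo (suc N)) + a (suc N) ∎
  where
  regroup : ∀ s x y z → (s + x) + (y - z) ≡ (s + (x - z)) + y
  regroup = ring-∀ ℚ-ring

U : ℕ → Coeffs
U n e = ∑ (λ i → v n i * E (μ n i) e) (upTo (suc n))

-- `U n` runs up to n so that its length grows by one with n, as the telescoping needs; the terms
-- beyond ⌊n/2⌋ vanish, which recovers the range of `ballotPart`.
U-short : ∀ n e → U n e ≡ ∑ (λ i → v n i * E (μ n i) e) (upTo (suc (n / 2)))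
U-short n e = trans (cong (λ N → ∑ f (upTo N)) split) (∑-extend vanish (n ∸ n / 2))
  where
  f : ℕ → ℚ
  f i = v n i * E (μ n i) e
  split : suc n ≡ n ∸ n / 2 ℕ.+ suc (n / 2)
  split = sym (trans (ℕₚ.+-suc _ (n / 2)) (cong suc (ℕₚ.m∸n+n≡m (m/n≤m n 2))))
  n<2i : ∀ i → suc (n / 2) ℕ.≤ i → n ℕ.< 2 ℕ.* i
  n<2i i le = ℕₚ.<-≤-trans
    (subst (n ℕ.<_) (ℕₚ.*-comm (suc (n / 2)) 2)
      (subst (ℕ._< suc (n / 2) ℕ.* 2) (sym (m≡m%n+[m/n]*n n 2)) (ℕₚ.+-monoˡ-< (n / 2 ℕ.* 2) (m%n<n n 2))))
    (ℕₚ.*-monoʳ-≤ 2 le)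
  vanish : ∀ i → suc (n / 2) ℕ.≤ i → f i ≡ 0ℚ
  vanish i le = trans (cong (_* E (μ n i) e) (v-0 n i (n<2i i le))) (ℚₚ.*-zeroˡ (E (μ n i) e))

coeff-ballotPart : ∀ n → coeff (ballotPart n) ≗ U n
coeff-ballotPart n e = trans (coeff-concatMap pairs (upTo (suc (n / 2))) e)
  (trans (∑-cong pair (upTo (suc (n / 2)))) (sym (U-short n e)))
  where
  tidy : ∀ a x y → a * x + (- a * y + 0ℚ) ≡ a * (x - y)
  tidy = ring-∀ ℚ-ring
  flip : ∀ e x y → e ℤ.- (x ℤ.- y) ≡ e ℤ.+ (y ℤ.- x)
  flip = ℤ-Solver.solve-∀
  pairs : ℕ → Poly
  pairs i = (+ (2 ℕ.* i) ℤ.- + (n ℕ.+ 1) , v n i) ∷ (μ n i , - v n i) ∷ []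
  pair : ∀ i → coeff (pairs i) e ≡ v n i * E (μ n i) e
  pair i = begin
    coeff (pairs i) e
      ≡⟨ coeff-∷ m′ (v n i) ((μ n i , - v n i) ∷ []) e ⟩
    v n i * δ (e ℤ.- m′) + coeff ((μ n i , - v n i) ∷ []) e
      ≡⟨ cong₂ (λ x y → v n i * δ x + y) (flip e (+ (2 ℕ.* i)) (+ (n ℕ.+ 1))) (coeff-∷ (μ n i) (- v n i) [] e) ⟩
    v n i * δ (e ℤ.+ μ n i) + (- v n i * δ (e ℤ.- μ n i) + 0ℚ)
      ≡⟨ tidy (v n i) (δ (e ℤ.+ μ n i)) (δ (e ℤ.- μ n i)) ⟩
    v n i * E (μ n i) e ∎
    where
    m′ = + (2 ℕ.* i) ℤ.- + (n ℕ.+ 1)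

U-zero : U 0 ≗ E 1ℤ
U-zero e = tidy (E 1ℤ e)
  where
  tidy : ∀ x → 1ℚ * x + 0ℚ ≡ x
  tidy = ring-∀ ℚ-ring

U-at-0 : ∀ n → U n 0ℤ ≡ 0ℚ
U-at-0 n = vanish (upTo (suc n))
  where
  vanish : ∀ is → ∑ (λ i → v n i * E (μ n i) 0ℤ) is ≡ 0ℚ
  vanish []       = refl
  vanish (i ∷ is) = cong₂ _+_ (trans (cong (v n i *_) (E-at-0 (μ n i))) (ℚₚ.*-zeroʳ (v n i))) (vanish is)

ballotCoeff-zero : ∀ n → ballotCoeff n 0 ≡ 1ℚ
ballotCoeff-zero n = ballotCoeff-diff n 0 ℕ.z≤n

-- Index i + 1 of `U (suc n)` collects the raised term of index i + 1 and the lowered term of index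
-- i, and `v-recurrence` combines their coefficients.
c-op-U : ∀ n → c-op (U n) ≗ U (suc n)
c-op-U n e = begin
  c-op (U n) e
    ≡⟨ L-∑ c-op-linear (λ i e → v n i * E (μ n i) e) (upTo (suc n)) e ⟩
  ∑ (λ i → c-op (λ e → v n i * E (μ n i) e) e) (upTo (suc n))
    ≡⟨ ∑-cong term (upTo (suc n)) ⟩
  ∑ (λ i → a i - b i) (upTo (suc n))
    ≡⟨ ℚₚ.+-identityʳ _ ⟨
  ∑ (λ i → a i - b i) (upTo (suc n)) + 0ℚ
    -- `a (suc n)` is the unpaired end term; its ballot coefficient lies past the range and
    -- vanishes.
    ≡⟨ +-congˡ (∑ (λ i → a i - b i) (upTo (suc n))) a-end ⟨
  ∑ (λ i → a i - b i) (upTo (suc n)) + a (suc n)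
    ≡⟨ ∑-telescope a b (λ i → v (suc n) i * E (μ (suc n) i) e) t₀ tₛ (suc n) ⟨
  U (suc n) e ∎
  where
  a b : ℕ → ℚ
  a i = v n i * E (μ n i ℤ.+ 1ℤ) e
  b i = v n i * E (μ n i ℤ.- 1ℤ) e
  distrib : ∀ c x y → c * (x - y) ≡ c * x - c * y
  distrib = ring-∀ ℚ-ring
  tidy : ∀ x y z → 0ℚ * x ≡ 0ℚ * y - 0ℚ * z
  tidy = ring-∀ ℚ-ring
  term : ∀ i → c-op (λ e → v n i * E (μ n i) e) e ≡ a i - b i
  term i = trans (c-op-linear .L-* (v n i) (E (μ n i)) e) (by-size (2 ℕ.* i ℕ.≤? n))
    where
    -- `c-op-E` needs a positive index: 2i ≤ n gives μ n i ≥ 1, and for larger i the coefficient is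
    -- zero.
    by-size : Dec (2 ℕ.* i ℕ.≤ n) → v n i * c-op (E (μ n i)) e ≡ a i - b i
    by-size (yes 2i≤n) = trans (cong (v n i *_) (c-op-E (n ∸ 2 ℕ.* i) (μ-≤ n i 2i≤n) e))
                           (distrib (v n i) (E (μ n i ℤ.+ 1ℤ) e) (E (μ n i ℤ.- 1ℤ) e))
    by-size (no 2i≰n) = begin
      v n i * c-op (E (μ n i)) e    ≡⟨ cong (_* c-op (E (μ n i)) e) vₙᵢ≡0 ⟩
      0ℚ * c-op (E (μ n i)) e       ≡⟨ tidy (c-op (E (μ n i)) e) x y ⟩
      0ℚ * x - 0ℚ * y               ≡⟨ cong (λ c → c * x - c * y) vₙᵢ≡0 ⟨
      a i - b i                     ∎
      where
      x = E (μ n i ℤ.+ 1ℤ) e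
      y = E (μ n i ℤ.- 1ℤ) e
      vₙᵢ≡0 : v n i ≡ 0ℚ
      vₙᵢ≡0 = v-0 n i (ℕₚ.≰⇒> 2i≰n)
  a-end : a (suc n) ≡ 0ℚ
  a-end = trans (cong (_* E (μ n (suc n) ℤ.+ 1ℤ) e) (v-0 n (suc n) (ℕₚ.m≤m+n (suc n) (suc n ℕ.+ 0))))
                (ℚₚ.*-zeroˡ (E (μ n (suc n) ℤ.+ 1ℤ) e))
  t₀ : v (suc n) 0 * E (μ (suc n) 0) e ≡ a 0
  t₀ = cong₂ (λ b m → 1ℚ * b * E m e)
    (trans (ballotCoeff-zero (suc n)) (sym (ballotCoeff-zero n))) (μ-suc n 0)
  tₛ : ∀ i → v (suc n) (suc i) * E (μ (suc n) (suc i)) e ≡ a (suc i) - b i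
  tₛ i = trans (v-recurrence n i e)
    (cong₂ (λ l m → v n (suc i) * E l e - v n i * E m e) (μ-suc n (suc i)) (μ-suc-suc n i))

-- Catalan numbers as coefficients of z⁻¹.

catalanHalf-even : ∀ n → n % 2 ≡ 0 → catalanHalf n ≡ catalan (n / 2)
catalanHalf-even n even =
  cong (if_then catalan (n / 2) else 0ℚ) (dec-true (n % 2 ℕ.≟ 0) even)

catalanHalf-odd : ∀ n → n % 2 ≢ 0 → catalanHalf n ≡ 0ℚ
catalanHalf-odd n odd =
  cong (if_then catalan (n / 2) else 0ℚ) (dec-false (n % 2 ℕ.≟ 0) odd)

-- At n = 2h the factor n + 1 - 2h is 1, and the defining expression of the Catalan number remains.
ballotCoeff-central : ∀ {n} h → n ≡ 2 ℕ.* h → ballotCoeff n h ≡ catalan h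
ballotCoeff-central h refl = cong (λ x → + x ℚ./ suc (2 ℕ.* h)) $
  trans (cong (ℕ._* c) (ℕₚ.m+n∸m≡n (2 ℕ.* h) 1)) (ℕₚ.*-identityˡ c)
  where
  c = (2 ℕ.* h ℕ.+ 1) C h

-- Among the E_m with m ≥ 1 only E₁ contains z⁻¹, and μ n i = 1 means n = 2i. So only the last term,
-- i = ⌊n/2⌋, can contribute, and it does so for even n.
U-at--1 : ∀ n → U n -[1+ 0 ] ≡ signℚ (n / 2) * catalanHalf n
U-at--1 n = begin
  U n -[1+ 0 ]                                ≡⟨ U-short n -[1+ 0 ] ⟩
  ∑ f (upTo (suc h))                          ≡⟨ ∑-last f id h ⟩
  ∑ f (upTo h) + f h                          ≡⟨ cong (_+ f h) (initial h ℕₚ.≤-refl) ⟩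
  0ℚ + f h                                    ≡⟨ ℚₚ.+-identityˡ (f h) ⟩
  f h                                         ≡⟨ final (n % 2) refl (m%n<n n 2) ⟩
  signℚ h * catalanHalf n                     ∎
  where
  h = n / 2
  f : ℕ → ℚ
  f i = v n i * E (μ n i) -[1+ 0 ]
  E-far : ∀ {i k} → μ n i ≡ + suc (suc k) → f i ≡ 0ℚ
  E-far {i} eq = trans (cong (λ m → v n i * E m -[1+ 0 ]) eq) (ℚₚ.*-zeroʳ (v n i))
  n≡ : n ≡ n % 2 ℕ.+ 2 ℕ.* h
  n≡ = trans (m≡m%n+[m/n]*n n 2) (cong (n % 2 ℕ.+_) (ℕₚ.*-comm h 2))
  μ-far : ∀ i → i ℕ.< h → ∃ λ k → μ n i ≡ + suc (suc k)
  μ-far i i<h = n ∸ suc (2 ℕ.* i) , μ≡ {n} {i} (sym (trans (sym (ℕₚ.+-suc _ (2 ℕ.* i))) (ℕₚ.m∸n+n≡m 2i<n)))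
    where
    2i<n : 2 ℕ.* i ℕ.< n
    2i<n = ℕₚ.<-≤-trans (ℕₚ.*-monoʳ-< 2 i<h) (subst (2 ℕ.* h ℕ.≤_) (sym n≡) (ℕₚ.m≤n+m (2 ℕ.* h) (n % 2)))
  initial : ∀ m → m ℕ.≤ h → ∑ f (upTo m) ≡ 0ℚ
  initial zero    _   = refl
  initial (suc m) m<h = trans (∑-last f id m)
    (cong₂ _+_ (initial m (ℕₚ.<⇒≤ m<h)) (E-far {m} (proj₂ (μ-far m m<h))))
  final : ∀ r → n % 2 ≡ r → r ℕ.< 2 → f h ≡ signℚ h * catalanHalf n
  final 0 even _ = begin
    v n h * E (μ n h) -[1+ 0 ]        ≡⟨ cong (λ m → v n h * E m -[1+ 0 ]) (μ≡ {n} {h} {0} n≡2h) ⟩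
    v n h * 1ℚ                        ≡⟨ ℚₚ.*-identityʳ (v n h) ⟩
    signℚ h * ballotCoeff n h         ≡⟨ cong (signℚ h *_) (ballotCoeff-central h n≡2h) ⟩
    signℚ h * catalan h               ≡⟨ cong (signℚ h *_) (catalanHalf-even n even) ⟨
    signℚ h * catalanHalf n           ∎
    where
    n≡2h : n ≡ 2 ℕ.* h
    n≡2h = trans n≡ (cong (ℕ._+ 2 ℕ.* h) even)
  -- For n = 2h + 1 the last term is a multiple of E₂, which has no z⁻¹.
  final 1 odd _ = begin
    f h                       ≡⟨ E-far {h} (μ≡ {n} {h} {1} (trans n≡ (cong (ℕ._+ 2 ℕ.* h) odd))) ⟩
    0ℚ                        ≡⟨ ℚₚ.*-zeroʳ (signℚ h) ⟨
    signℚ h * 0ℚ              ≡⟨ cong (signℚ h *_) (catalanHalf-odd n (λ even → contradiction (trans (sym even) odd) λ ())) ⟨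
    signℚ h * catalanHalf n   ∎
  final (suc (suc r)) _ (ℕ.s≤s (ℕ.s≤s ()))

-- Evaluation on words and the global sign.

κ : List ℕ → ℚ
κ = foldr (λ n c → U n -[1+ 0 ] * c) 1ℚ

-- A power of 𝐜 stands before a 𝐝 or at the end of the word; in both cases what follows evaluates to
-- a multiple of E₁ = U₀, and `c-op-U` is iterated.
𝒦Θ-cPow : ∀ c {w} → 𝒦Θ w ≗ (λ e → c * E 1ℤ e) → ∀ n → 𝒦Θ (cPow n ++ w) ≗ λ e → c * U n e
𝒦Θ-cPow c     eq zero    e = trans (eq e) (cong (c *_) (sym (U-zero e)))
𝒦Θ-cPow c {w} eq (suc n) e = begin
  𝒦Θ (𝐜 ∷ cPow n ++ w) e       ≡⟨ 𝒦Θ-𝐜 (cPow n ++ w) e ⟩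
  c-op (𝒦Θ (cPow n ++ w)) e    ≡⟨ c-op-linear .L-cong (𝒦Θ-cPow c eq n) e ⟩
  c-op (λ e → c * U n e) e     ≡⟨ c-op-linear .L-* c (U n) e ⟩
  c * c-op (U n) e             ≡⟨ cong (c *_) (c-op-U n e) ⟩
  c * U (suc n) e              ∎

-- Each 𝐝 replaces the polynomial of its tail by that polynomial's coefficient of z⁻¹ times E₁, and
-- these coefficients accumulate in `κ`.
𝒦Θ-cdWord : ∀ n₀ ns → 𝒦Θ (cdWord n₀ ns) ≗ λ e → κ ns * U n₀ e
𝒦Θ-cdWord n₀ [] = subst (λ w → 𝒦Θ w ≗ λ e → 1ℚ * U n₀ e) (++-identityʳ (cPow n₀)) (𝒦Θ-cPow 1ℚ empty n₀)
  where
  tidy : ∀ x → x + 0ℚ ≡ 1ℚ * x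
  tidy = ring-∀ ℚ-ring
  empty : 𝒦Θ [] ≗ λ e → 1ℚ * E 1ℤ e
  empty e = trans (tidy (𝒦L-bits [] e)) (cong (1ℚ *_) (𝒦L-bits-[] e))
𝒦Θ-cdWord n₀ (n ∷ ns) = 𝒦Θ-cPow (κ (n ∷ ns)) after-𝐝 n₀
  where
  u = U n -[1+ 0 ]
  swap : ∀ k u x → k * (u * x) ≡ u * k * x
  swap = ring-∀ ℚ-ring
  after-𝐝 : 𝒦Θ (𝐝 ∷ cdWord n ns) ≗ λ e → u * κ ns * E 1ℤ e
  after-𝐝 e = begin
    𝒦Θ (𝐝 ∷ cdWord n ns) e           ≡⟨ 𝒦Θ-𝐝 (cdWord n ns) e ⟩
    d-op (𝒦Θ (cdWord n ns)) e        ≡⟨ d-op-linear .L-cong (𝒦Θ-cdWord n ns) e ⟩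
    d-op (λ e → κ ns * U n e) e      ≡⟨ d-op-linear .L-* (κ ns) (U n) e ⟩
    κ ns * d-op (U n) e              ≡⟨ cong (κ ns *_) (d-op-E (U n) (U-at-0 n) e) ⟩
    κ ns * (u * E 1ℤ e)              ≡⟨ swap (κ ns) u (E 1ℤ e) ⟩
    u * κ ns * E 1ℤ e                ∎

deg-cPow : ∀ n w → deg (cPow n ++ w) ≡ n ℕ.+ deg w
deg-cPow zero    w = refl
deg-cPow (suc n) w = cong suc (deg-cPow n w)

-- This is |w| - n₀, written additively so that its half can be split along the list.
tail-deg : List ℕ → ℕ
tail-deg []       = 0
tail-deg (n ∷ ns) = 2 ℕ.+ (n ℕ.+ tail-deg ns)

deg-cdWord : ∀ n ns → deg (cdWord n ns) ≡ n ℕ.+ tail-deg ns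
deg-cdWord n []       = trans (cong deg (sym (++-identityʳ (cPow n)))) (deg-cPow n [])
deg-cdWord n (m ∷ ns) =
  trans (deg-cPow n (𝐝 ∷ cdWord m ns)) (cong (λ d → n ℕ.+ (2 ℕ.+ d)) (deg-cdWord m ns))

signℚ-+ : ∀ a b → signℚ (a ℕ.+ b) ≡ signℚ a * signℚ b
signℚ-+ zero    b = sym (ℚₚ.*-identityˡ (signℚ b))
signℚ-+ (suc a) b = trans (cong -_ (signℚ-+ a b)) (ℚₚ.neg-distribˡ-* (signℚ a) (signℚ b))

catalans : List ℕ → ℚ
catalans = foldr (λ n c → catalanHalf n * c) 1ℚ

-- For even n, halving distributes over n + d and the sign splits into one factor per block. For odd
-- n it need not, but the Catalan factor makes both sides zero.
signed-catalans : ∀ ns → signℚ (length ns ℕ.+ tail-deg ns / 2) * catalans ns ≡ κ ns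
signed-catalans []       = refl
signed-catalans (n ∷ ns) = begin
  signℚ (suc l ℕ.+ (2 ℕ.+ (n ℕ.+ d)) / 2) * (cat * P)
    ≡⟨ cong (λ x → signℚ (suc l ℕ.+ x) * (cat * P)) (+-distrib-/-∣ˡ {2} (n ℕ.+ d) {2} ∣-refl) ⟩
  signℚ (suc l ℕ.+ suc ((n ℕ.+ d) / 2)) * (cat * P)
    -- The 𝐝 supplies two signs, one through the number of 𝐝s and one through half its degree 2;
    -- they cancel.
    ≡⟨ cong (λ x → - signℚ x * (cat * P)) (ℕₚ.+-suc l ((n ℕ.+ d) / 2)) ⟩
  - - signℚ (l ℕ.+ (n ℕ.+ d) / 2) * (cat * P)
    ≡⟨ evenly (n % 2 ℕ.≟ 0) ⟩
  signℚ h * cat * (signℚ (l ℕ.+ d / 2) * P)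
    ≡⟨ cong₂ _*_ (U-at--1 n) (sym (signed-catalans ns)) ⟨
  U n -[1+ 0 ] * κ ns ∎
  where
  l = length ns
  d = tail-deg ns
  h = n / 2
  cat = catalanHalf n
  P = catalans ns
  regroup : ∀ l h d c p → - - (l * (h * d)) * (c * p) ≡ h * c * (l * d * p)
  regroup = ring-∀ ℚ-ring
  vanish : ∀ x y h p → x * (0ℚ * p) ≡ h * 0ℚ * (y * p)
  vanish = ring-∀ ℚ-ring
  evenly : Dec (n % 2 ≡ 0) →
    - - signℚ (l ℕ.+ (n ℕ.+ d) / 2) * (cat * P) ≡ signℚ h * cat * (signℚ (l ℕ.+ d / 2) * P)
  evenly (no odd) = begin
    - - signℚ (l ℕ.+ (n ℕ.+ d) / 2) * (cat * P)
      ≡⟨ cong (λ c → - - signℚ (l ℕ.+ (n ℕ.+ d) / 2) * (c * P)) (catalanHalf-odd n odd) ⟩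
    - - signℚ (l ℕ.+ (n ℕ.+ d) / 2) * (0ℚ * P)
      ≡⟨ vanish (- - signℚ (l ℕ.+ (n ℕ.+ d) / 2)) (signℚ (l ℕ.+ d / 2)) (signℚ h) P ⟩
    signℚ h * 0ℚ * (signℚ (l ℕ.+ d / 2) * P)
      ≡⟨ cong (λ c → signℚ h * c * (signℚ (l ℕ.+ d / 2) * P)) (catalanHalf-odd n odd) ⟨
    signℚ h * cat * (signℚ (l ℕ.+ d / 2) * P) ∎
  evenly (yes even) = begin
    - - signℚ (l ℕ.+ (n ℕ.+ d) / 2) * (cat * P)
      ≡⟨ cong (λ x → - - signℚ (l ℕ.+ x) * (cat * P)) (+-distrib-/-∣ˡ {n} d {2} (m%n≡0⇒n∣m n 2 even)) ⟩
    - - signℚ (l ℕ.+ (h ℕ.+ d / 2)) * (cat * P)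
      ≡⟨ cong (λ x → - - x * (cat * P)) (trans (signℚ-+ l (h ℕ.+ d / 2)) (cong (signℚ l *_) (signℚ-+ h (d / 2)))) ⟩
    - - (signℚ l * (signℚ h * signℚ (d / 2))) * (cat * P)
      ≡⟨ regroup (signℚ l) (signℚ h) (signℚ (d / 2)) cat P ⟩
    signℚ h * cat * (signℚ l * signℚ (d / 2) * P)
      ≡⟨ cong (λ x → signℚ h * cat * (x * P)) (signℚ-+ l (d / 2)) ⟨
    signℚ h * cat * (signℚ (l ℕ.+ d / 2) * P) ∎

theorem3p3 : (n0 : ℕ) (ns : List ℕ) → Ξ (cdWord n0 ns) ≈P RHS n0 ns
theorem3p3 n0 ns e = begin
  coeff (Ξ (cdWord n0 ns)) e
    ≡⟨ coeff-Ξ (cdWord n0 ns) e ⟩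
  𝒦Θ (cdWord n0 ns) e
    ≡⟨ 𝒦Θ-cdWord n0 ns e ⟩
  κ ns * U n0 e
    ≡⟨ cong₂ _*_ (signed-catalans ns) (coeff-ballotPart n0 e) ⟨
  signℚ (length ns ℕ.+ tail-deg ns / 2) * catalans ns * coeff (ballotPart n0) e
    ≡⟨ cong (λ d → signℚ (length ns ℕ.+ d / 2) * catalans ns * coeff (ballotPart n0) e) deg≡ ⟨
  signℚ (length ns ℕ.+ (deg (cdWord n0 ns) ∸ n0) / 2) * catalans ns * coeff (ballotPart n0) e
    ≡⟨ coeff-scaleP (signℚ (length ns ℕ.+ (deg (cdWord n0 ns) ∸ n0) / 2) * catalans ns) (ballotPart n0) e ⟨
  coeff (RHS n0 ns) e ∎
  where
  deg≡ : deg (cdWord n0 ns) ∸ n0 ≡ tail-deg ns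
  deg≡ = trans (cong (_∸ n0) (deg-cdWord n0 ns)) (ℕₚ.m+n∸m≡n n0 (tail-deg ns))
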